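{- For all integers $k\ge 1$ and $r\ge 2$ there exists a constant $n_0(k,r)$, depending only on $k$ and $r$, such that for every integer $n\ge n_0(k,r)$, $$\mathrm{ex}(n,K_r,(k+1)K_r)=K_r\bigl(K_k+T_{r-1}(n-k)\bigr),$$ and $K_k+T_{r-1}(n-k)$ is the unique extremal graph; that is, up to isomorphism, $K_k+T_{r-1}(n-k)$ is the only $(k+1)K_r$-free graph on $n$ vertices containing exactly $\mathrm{ex}(n,K_r,(k+1)K_r)$ copies of $K_r$.
   Context: All graphs are finite and simple. $K_m$ denotes the complete graph on $m$ vertices. For a graph $F$, $kF$ denotes the disjoint union of $k$ copies of $F$. A graph is $F$-free if it contains no subgraph (not necessarily induced) isomorphic to $F$. For a graph $G$, $K_s(G)$ denotes the number of copies of $K_s$ in $G$ (complete subgraphs on $s$ vertices). The generalized Turán number $\mathrm{ex}(n,K_s,F)$ is the maximum of $K_s(G)$ over all $F$-free graphs $G$ on $n$ vertices. The join $G+H$ is obtained from the disjoint union of $G$ and $H$ by adding all edges between $V(G)$ and $V(H)$. The Turán graph $T_r(n)$ is the complete $r$-partite graph on $n$ vertices whose part sizes differ pairwise by at most one; in particular $T_1(n)$ is the graph on $n$ vertices with no edges. -}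

module Defs where

open import Data.Bool.Base using (true; false)
open import Data.Fin.Base using (Fin; toℕ; splitAt; remQuot)
open import Data.Fin.Properties using (_≟_; all?)
open import Data.Fin.Subset using (Subset; _∈_; ∣_∣)
open import Data.Fin.Subset.Properties using (_∈?_)
open import Data.List.Base using (List; []; _∷_; _++_; map; filter; length)
open import Data.Nat.Base as ℕ using (ℕ; zero; suc; NonZero; _≤_; _%_)
import Data.Nat.Properties as ℕ
open import Data.Product.Base using (Σ; ∃; _×_; _,_; proj₁; proj₂)
open import Data.Sum.Base using (_⊎_; inj₁; inj₂)
open import Data.Unit.Base using (⊤; tt)
open import Data.Vec.Base as Vec using (Vec)
open import Function.Base using (_∘_)
open import Function.Bundles using (_↔_; _⇔_; module Inverse)
open import Function.Definitions using (Injective)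
open import Level using (0ℓ)
open import Relation.Binary.Core using (Rel)
open import Relation.Binary.Definitions using (Decidable; Symmetric; Irreflexive)
open import Relation.Binary.PropositionalEquality.Core using (_≡_; _≢_; refl; sym)
open import Relation.Nullary.Decidable using (yes; ¬?; _×-dec_; _→-dec_)
open import Relation.Nullary.Negation using (¬_)
import Relation.Unary as U

record Graph (n : ℕ) : Set₁ where
  field
    Adj    : Rel (Fin n) 0ℓ
    adj?   : Decidable Adj
    symm   : Symmetric Adj
    irrefl : Irreflexive _≡_ Adj

open Graph public

private
  variable
    m n : ℕ

infix 4 _⊑_ _≅_

-- F ⊑ G: some subgraph of G, not necessarily induced, is isomorphic to F.
_⊑_ : Graph m → Graph n → Set
_⊑_ {m} {n} F G =
  Σ (Fin m → Fin n) λ f →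
    Injective _≡_ _≡_ f × (∀ x y → Adj F x y → Adj G (f x) (f y))

_IsFreeOf_ : Graph n → Graph m → Set
G IsFreeOf F = ¬ (F ⊑ G)

_≅_ : Graph m → Graph n → Set
_≅_ {m} {n} G H =
  Σ (Fin m ↔ Fin n) λ f →
    ∀ x y → Adj G x y ⇔ Adj H (Inverse.to f x) (Inverse.to f y)

K : (n : ℕ) → Graph n
K n .Adj          = _≢_
K n .adj? i j     = ¬? (i ≟ j)
K n .symm i≢j     = i≢j ∘ sym
K n .irrefl p i≢j = i≢j p

-- The residue classes modulo r, restricted to {0, …, n - 1}, have sizes that
-- differ pairwise by at most one; they are the parts of the Turán graph.
turán : (r : ℕ) .{{_ : NonZero r}} (n : ℕ) → Graph n
turán r n .Adj i j          = toℕ i % r ≢ toℕ j % r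
turán r n .adj? i j         = ¬? (toℕ i % r ℕ.≟ toℕ j % r)
turán r n .symm i≢j         = i≢j ∘ sym
turán r n .irrefl refl i≢i  = i≢i refl

module _ (G : Graph m) (H : Graph n) where

  JoinAdj : Rel (Fin m ⊎ Fin n) 0ℓ
  JoinAdj (inj₁ x) (inj₁ y) = Adj G x y
  JoinAdj (inj₁ _) (inj₂ _) = ⊤
  JoinAdj (inj₂ _) (inj₁ _) = ⊤
  JoinAdj (inj₂ x) (inj₂ y) = Adj H x y

  joinAdj? : Decidable JoinAdj
  joinAdj? (inj₁ x) (inj₁ y) = adj? G x y
  joinAdj? (inj₁ _) (inj₂ _) = yes tt
  joinAdj? (inj₂ _) (inj₁ _) = yes tt
  joinAdj? (inj₂ x) (inj₂ y) = adj? H x y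

  joinAdj-sym : Symmetric JoinAdj
  joinAdj-sym {inj₁ _} {inj₁ _} a = symm G a
  joinAdj-sym {inj₁ _} {inj₂ _} _ = tt
  joinAdj-sym {inj₂ _} {inj₁ _} _ = tt
  joinAdj-sym {inj₂ _} {inj₂ _} a = symm H a

  joinAdj-irrefl : ∀ u → ¬ JoinAdj u u
  joinAdj-irrefl (inj₁ _) a = irrefl G refl a
  joinAdj-irrefl (inj₂ _) a = irrefl H refl a

infixl 6 _+ᴳ_

-- The first m vertices carry G and the last n carry H.
_+ᴳ_ : Graph m → Graph n → Graph (m ℕ.+ n)
_+ᴳ_ {m} G H = record
  { Adj    = λ i j → JoinAdj G H (splitAt m i) (splitAt m j)
  ; adj?   = λ i j → joinAdj? G H (splitAt m i) (splitAt m j)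
  ; symm   = λ {i} {j} → joinAdj-sym G H {splitAt m i} {splitAt m j}
  ; irrefl = λ { {i} refl → joinAdj-irrefl G H (splitAt m i) }
  }

infixr 7 _·_

-- Disjoint union of k copies of F: remQuot m sends a vertex to the pair
-- (index of its copy, vertex of F).
_·_ : (k : ℕ) → Graph m → Graph (k ℕ.* m)
_·_ {m} k F = record
  { Adj    = λ i j → copy i ≡ copy j × Adj F (vertex i) (vertex j)
  ; adj?   = λ i j → (copy i ≟ copy j) ×-dec adj? F (vertex i) (vertex j)
  ; symm   = λ (p , a) → sym p , symm F a
  ; irrefl = λ { refl (_ , a) → irrefl F refl a }
  }
  where
  copy : Fin (k ℕ.* m) → Fin k
  copy i = proj₁ (remQuot {k} m i)

  vertex : Fin (k ℕ.* m) → Fin m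
  vertex i = proj₂ (remQuot {k} m i)

subsets : (n : ℕ) → List (Subset n)
subsets zero    = Vec.[] ∷ []
subsets (suc n) = map (true Vec.∷_) (subsets n) ++ map (false Vec.∷_) (subsets n)

-- A copy of K s in G is determined by its vertex set.
IsClique : Graph n → ℕ → Subset n → Set
IsClique G s p =
  ∣ p ∣ ≡ s × (∀ i j → i ∈ p → j ∈ p → i ≢ j → Adj G i j)

isClique? : (G : Graph n) (s : ℕ) → U.Decidable (IsClique G s)
isClique? G s p =
  (∣ p ∣ ℕ.≟ s) ×-dec
  all? λ i → all? λ j →
    (i ∈? p) →-dec ((j ∈? p) →-dec (¬? (i ≟ j) →-dec adj? G i j))

#K : (s : ℕ) → Graph n → ℕ
#K {n} s G = length (filter (isClique? G s) (subsets n))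

-- e is the maximum of #K s over the F-free graphs on n vertices, that is,
-- ex(n, K s, F) = e.
record IsEx (n s : ℕ) (F : Graph m) (e : ℕ) : Set₁ where
  field
    attained : ∃ λ (G : Graph n) → G IsFreeOf F × #K s G ≡ e
    maximal  : ∀ (G : Graph n) → G IsFreeOf F → #K s G ≤ e

IsExtremal : (s : ℕ) (F : Graph m) → Graph n → Set₁
IsExtremal {n = n} s F G = G IsFreeOf F × IsEx n s F (#K s G)

{-# OPTIONS --safe #-}

-- Call a vertex heavy if it lies in more than about nʳ⁻² copies of K r.  A
-- heavy vertex can be added to any packing of boundedly many disjoint copies
-- of K r that avoids it, so a (k + 1) K r-free graph has at most k heavy
-- vertices; since k r vertices meet all copies of K r, fewer than k heavy
-- vertices give at most (k - 1) K_{r-1}(T_{r-1}(n)) + O(nʳ⁻²) copies, too few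
-- for large n.  With exactly k heavy vertices the rest is K r-free, and the
-- count is bounded by Zykov's theorem, applied to K_s for every s < r.
-- Zykov's theorem is proved by removing r - 1 vertices that include a largest
-- clique, so that an i-clique of the rest has at most r - 1 - i common
-- neighbours among them; removing one vertex from each part of T_{r-1}(n)
-- makes this an equality.
module Submission where

import Algebra.Properties.CommutativeSemigroup as CommSemigroup
open import Data.Bool.Base using (true; false)
open import Data.Empty using (⊥)
import Data.Fin.Base as Fin
open import Data.Fin.Base using (Fin; zero; suc; toℕ; fromℕ<; splitAt; join; remQuot; combine; cast; _↑ˡ_; _↑ʳ_)
import Data.Fin.Properties as Fin
import Data.Fin.Subset as Subset
open import Data.Fin.Subset using (Subset; ∣_∣)
open import Data.List.Base using (List; []; _∷_; _++_; map; filter; length; take; drop; lookup; tabulate; allFin; upTo; applyUpTo)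
open import Data.List.Membership.Propositional using (_∈_)
open import Data.List.Membership.Propositional.Properties
  using (∈-∃++; ∈-++⁻; ∈-++⁺ˡ; ∈-++⁺ʳ; ∈-filter⁺; ∈-filter⁻; ∈-applyUpTo⁺; ∈-applyUpTo⁻; ∈-lookup; ∈-allFin; ∈-tabulate⁻)
open import Data.List.Properties
open import Data.List.Relation.Binary.Permutation.Propositional
  using (_↭_; ↭-refl; ↭-reflexive; ↭-sym; ↭-trans; refl; prep; swap; trans)
import Data.List.Relation.Binary.Permutation.Propositional.Properties as ↭
open import Data.List.Relation.Binary.Sublist.Propositional using (_⊆_; []; _∷_; _∷ʳ_; ⊆-refl; ⊆-trans)
import Data.List.Relation.Binary.Sublist.Propositional.Properties as ⊆
open import Data.List.Relation.Unary.All as All using (All; []; _∷_)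
import Data.List.Relation.Unary.All.Properties as All
open import Data.List.Relation.Unary.AllPairs as AllPairs using (AllPairs; []; _∷_)
import Data.List.Relation.Unary.AllPairs.Properties as AllPairs
open import Data.List.Relation.Unary.Any using (here; there)
open import Data.List.Relation.Unary.Unique.Propositional using (Unique)
import Data.List.Relation.Unary.Unique.Propositional.Properties as Unique
open import Data.Nat.Base
open import Data.Nat.Combinatorics using (_C_; nCn≡1; k>n⇒nCk≡0; nCk+nC[k+1]≡[n+1]C[k+1])
open import Data.Nat.DivMod
  using (m<n⇒m%n≡m; [m+n]%n≡m%n; m%n<n; m*n/n≡m; /-monoˡ-≤; m/n*n≤m; m≡m%n+[m/n]*n)
open import Data.Nat.Induction using (<-wellFounded)
open import Data.Nat.Properties
open import Data.Nat.Solver using (module +-*-Solver)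
open import Data.Product.Base using (∃; ∃₂; _×_; _,_; proj₁; proj₂)
open import Data.Sum.Base using (_⊎_; inj₁; inj₂; [_,_]′)
open import Data.Unit.Base using (tt)
import Data.Vec.Base as Vec
open import Data.Vec.Base using (here; there)
open import Defs
open import Function.Base using (_∘_; id; case_of_)
open import Function.Bundles using (_⇔_; mk⇔; mk↔ₛ′; module Inverse; module Injection; module Equivalence)
open import Function.Properties.Inverse using (↔⇒↣; ↔-sym)
open import Induction.WellFounded using (Acc; acc)
open import Level using (0ℓ)
open import Relation.Binary.Core using (Rel)
open import Relation.Binary.Definitions using (Decidable; Symmetric; Irreflexive; tri<; tri≈; tri>)
open import Relation.Binary.PropositionalEquality as ≡
  using (_≡_; _≢_; refl; sym; cong; cong₂; subst; subst₂; module ≡-Reasoning)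
open import Relation.Nullary.Decidable using (Dec; yes; no; ¬?; does; decidable-stable; _×-dec_)
open import Relation.Nullary.Negation using (¬_; contradiction)
import Relation.Unary as U

-- Zykov's bound is used for all orders at once: with k apex vertices, the number of r-cliques is at
-- most a positive combination of the numbers of cliques of orders at most r in the rest, and the
-- induction step for one order draws on all smaller orders as well. The obstacle in that step is a
-- largest clique with fewer than r - 1 vertices. Arbitrary further vertices fill it up; even if
-- they are adjacent to everything, they cost no more than the bound allows. The target is at least
-- k K_{r-1}(T_{r-1}(n-k)), so the case of few heavy vertices falls short by about one
-- K_{r-1}(T_{r-1}(n)), of order n^(r-1), while all errors have order n^(r-2). Uniqueness is the
-- equality case of the same estimates. Sums are compared term by term, so equal sums force equal
-- terms. The (r-1)-cliques of the rest enter with coefficient k > 0, so the rest is extremal at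
-- that order, hence a Turán graph. Each of its vertices then lies in an (r-1)-clique, so a missing
-- edge at an apex would lose a copy.

private
  variable
    V : Set

-- Binomial coefficients, sums with no slack, filtered lists

C-pascal : ∀ n k → suc n C suc k ≡ n C k + n C suc k
C-pascal n k = sym (nCk+nC[k+1]≡[n+1]C[k+1] n k)

C-monoˡ-≤ : ∀ {m n} k → m ≤ n → m C k ≤ n C k
C-monoˡ-≤ zero    _   = ≤-refl
C-monoˡ-≤ {n = n} (suc k) z≤n = z≤n
C-monoˡ-≤ {suc m} {suc n} (suc k) (s≤s m≤n) = begin
  suc m C suc k       ≡⟨ C-pascal m k ⟩
  m C k + m C suc k   ≤⟨ +-mono-≤ (C-monoˡ-≤ k m≤n) (C-monoˡ-≤ (suc k) m≤n) ⟩
  n C k + n C suc k   ≡⟨ C-pascal n k ⟨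
  suc n C suc k       ∎
  where open ≤-Reasoning

k≤n⇒0<nCk : ∀ {n k} → k ≤ n → 0 < n C k
k≤n⇒0<nCk {k = k} k≤n = ≤-trans (≤-reflexive (sym (nCn≡1 k))) (C-monoˡ-≤ k k≤n)

0<nCk⇒k≤n : ∀ {n k} → 0 < n C k → k ≤ n
0<nCk⇒k≤n {n} {k} 0<C with k ≤? n
... | yes k≤n = k≤n
... | no  k≰n = contradiction (k>n⇒nCk≡0 (≰⇒> k≰n)) (>⇒≢ 0<C)

-- All equality cases rest on this: when both summands are dominated, equal sums leave no slack in
-- either.
+-≤-≡⇒≡ʳ : ∀ {a b c d} → a ≤ c → b ≤ d → a + b ≡ c + d → b ≡ d
+-≤-≡⇒≡ʳ {a} {b} {c} {d} a≤c b≤d eq = ≤-antisym b≤d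
  (+-cancelˡ-≤ c d b (≤-trans (≤-reflexive (sym eq)) (+-monoˡ-≤ b a≤c)))

+-≤-≡⇒≡ˡ : ∀ {a b c d} → a ≤ c → b ≤ d → a + b ≡ c + d → a ≡ c
+-≤-≡⇒≡ˡ {a} {b} {c} {d} a≤c b≤d eq =
  +-≤-≡⇒≡ʳ b≤d a≤c (≡.trans (+-comm b a) (≡.trans eq (+-comm c d)))

+-interchange : ∀ a b c d → (a + b) + (c + d) ≡ (a + c) + (b + d)
+-interchange = CommSemigroup.interchange +-commutativeSemigroup

x+[y+z]≡y+[x+z] : ∀ x y z → x + (y + z) ≡ y + (x + z)
x+[y+z]≡y+[x+z] x y z = CommSemigroup.x∙yz≈y∙xz +-commutativeSemigroup x y z

0<m+n⇒0<m⊎0<n : ∀ m {n} → 0 < m + n → 0 < m ⊎ 0 < n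
0<m+n⇒0<m⊎0<n zero    p = inj₂ p
0<m+n⇒0<m⊎0<n (suc m) _ = inj₁ z<s

module _ {P : U.Pred V 0ℓ} (P? : U.Decidable P) where

  filter-↭ : ∀ {xs ys} → xs ↭ ys → filter P? xs ↭ filter P? ys
  filter-↭ refl = ↭-refl
  filter-↭ (prep x p) with does (P? x)
  ... | true  = prep x (filter-↭ p)
  ... | false = filter-↭ p
  filter-↭ (swap x y p) with does (P? x) in ex | does (P? y) in ey
  ... | true  | true  rewrite ex | ey = swap x y (filter-↭ p)
  ... | true  | false rewrite ex | ey = prep x (filter-↭ p)
  ... | false | true  rewrite ex | ey = prep y (filter-↭ p)
  ... | false | false rewrite ex | ey = filter-↭ p
  filter-↭ (trans p q) = trans (filter-↭ p) (filter-↭ q)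

  filter-mono-⊆ : ∀ {xs ys} → xs ⊆ ys → filter P? xs ⊆ filter P? ys
  filter-mono-⊆ = ⊆.filter⁺ P? P? λ { refl → id }

  length-filter-∁ : ∀ xs → length xs ≡ length (filter P? xs) + length (filter (¬? ∘ P?) xs)
  length-filter-∁ []       = refl
  length-filter-∁ (x ∷ xs) with P? x
  ... | yes _ = cong suc (length-filter-∁ xs)
  ... | no  _ = ≡.trans (cong suc (length-filter-∁ xs)) (sym (+-suc _ _))

  module _ {Q : U.Pred V 0ℓ} (Q? : U.Decidable Q) where

    filter-comm : ∀ xs → filter P? (filter Q? xs) ≡ filter Q? (filter P? xs)
    filter-comm []       = refl
    filter-comm (x ∷ xs) with does (P? x) in p | does (Q? x) in q
    ... | true  | true  rewrite p | q = cong (x ∷_) (filter-comm xs)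
    ... | true  | false rewrite q     = filter-comm xs
    ... | false | true  rewrite p     = filter-comm xs
    ... | false | false               = filter-comm xs

⊆⇒↭ : ∀ {xs ys : List V} → xs ⊆ ys → ∃ λ zs → ys ↭ xs ++ zs
⊆⇒↭ []          = [] , ↭-refl
⊆⇒↭ {xs = xs} (y ∷ʳ τ) with zs , p ← ⊆⇒↭ τ =
  y ∷ zs , ↭-trans (prep y p) (↭-sym (↭.shift y xs zs))
⊆⇒↭ (refl ∷ τ)  with zs , p ← ⊆⇒↭ τ = zs , prep _ p

-- Counting cliques in a list of vertices

module Cliques {Adj : Rel V 0ℓ} (adj? : Decidable Adj) where

  nbrs : V → List V → List V
  nbrs x = filter (adj? x)

  non : V → List V → List V
  non x = filter (¬? ∘ adj? x)

  -- Each clique is counted at its first vertex in the list, so deletions and neighbourhoods remain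
  -- plain sublists. Independence of the order is `cl-↭`.
  cl : ℕ → List V → ℕ
  cl zero    _        = 1
  cl (suc s) []       = 0
  cl (suc s) (x ∷ xs) = cl s (nbrs x xs) + cl (suc s) xs

  Clique : List V → Set
  Clique = AllPairs Adj

  cl-mono-⊆ : ∀ s {xs ys} → xs ⊆ ys → cl s xs ≤ cl s ys
  cl-mono-⊆ zero    _          = ≤-refl
  cl-mono-⊆ (suc s) []         = ≤-refl
  cl-mono-⊆ (suc s) (y ∷ʳ τ)   = ≤-trans (cl-mono-⊆ (suc s) τ) (m≤n+m _ _)
  cl-mono-⊆ (suc s) (refl ∷ τ) =
    +-mono-≤ (cl-mono-⊆ s (filter-mono-⊆ (adj? _) τ)) (cl-mono-⊆ (suc s) τ)

  cl-nbrs : ∀ s x xs → cl s (nbrs x xs) ≤ cl s xs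
  cl-nbrs s x xs = cl-mono-⊆ s (⊆.filter-⊆ (adj? x) xs)

  cl≤C : ∀ s xs → cl s xs ≤ length xs C s
  cl≤C zero    xs       = ≤-refl
  cl≤C (suc s) []       = z≤n
  cl≤C (suc s) (x ∷ xs) = begin
    cl s (nbrs x xs) + cl (suc s) xs      ≤⟨ +-mono-≤ (cl-nbrs s x xs) (cl≤C (suc s) xs) ⟩
    cl s xs + length xs C suc s           ≤⟨ +-monoˡ-≤ _ (cl≤C s xs) ⟩
    length xs C s + length xs C suc s     ≡⟨ C-pascal (length xs) s ⟨
    suc (length xs) C suc s               ∎
    where open ≤-Reasoning

  cl-Clique : ∀ s {xs} → Clique xs → cl s xs ≡ length xs C s
  cl-Clique zero    _  = refl
  cl-Clique (suc s) [] = refl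
  cl-Clique (suc s) {x ∷ xs} (px ∷ pxs) = begin
    cl s (nbrs x xs) + cl (suc s) xs      ≡⟨ cong (λ ys → cl s ys + cl (suc s) xs) (filter-all (adj? x) px) ⟩
    cl s xs + cl (suc s) xs               ≡⟨ cong₂ _+_ (cl-Clique s pxs) (cl-Clique (suc s) pxs) ⟩
    length xs C s + length xs C suc s     ≡⟨ C-pascal (length xs) s ⟨
    suc (length xs) C suc s               ∎
    where open ≡-Reasoning

  cl≤^ : ∀ s {n} xs → length xs ≤ n → cl s xs ≤ n ^ s
  cl≤^ zero    xs       _ = ≤-refl
  cl≤^ (suc s) []       _ = z≤n
  cl≤^ (suc s) {suc n} (x ∷ xs) (s≤s ∣xs∣≤n) = +-mono-≤
    (≤-trans (cl-nbrs s x xs) (cl≤^ s xs (m≤n⇒m≤1+n ∣xs∣≤n)))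
    (≤-trans (cl≤^ (suc s) xs ∣xs∣≤n) (*-monoʳ-≤ n (^-monoˡ-≤ s (n≤1+n n))))

  -- Each vertex of `S` accounts for at most `n ^ s` cliques. This crude estimate is a main source
  -- of the error terms.
  cl-++≤ : ∀ s {n} S R → length (S ++ R) ≤ n → cl (suc s) (S ++ R) ≤ length S * n ^ s + cl (suc s) R
  cl-++≤ s []      R _ = ≤-refl
  cl-++≤ s {n} (x ∷ S) R l≤n = begin
    cl s (nbrs x (S ++ R)) + cl (suc s) (S ++ R)
      ≤⟨ +-mono-≤ (≤-trans (cl-nbrs s x (S ++ R)) (cl≤^ s (S ++ R) l≤n′)) (cl-++≤ s S R l≤n′) ⟩
    n ^ s + (length S * n ^ s + cl (suc s) R)
      ≡⟨ +-assoc (n ^ s) _ _ ⟨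
    suc (length S) * n ^ s + cl (suc s) R ∎
    where
    open ≤-Reasoning
    l≤n′ = ≤-trans (n≤1+n _) l≤n

  cl>0⇒Clique : ∀ s xs → 0 < cl s xs → ∃ λ ys → ys ⊆ xs × Clique ys × length ys ≡ s
  cl>0⇒Clique zero xs _ = [] , ⊆.[]⊆-universal xs , [] , refl
  cl>0⇒Clique (suc s) (x ∷ xs) c>0 =
    [ (λ p → let ys , τ , c , l = cl>0⇒Clique s (nbrs x xs) p in
        x ∷ ys , refl ∷ ⊆-trans τ (⊆.filter-⊆ (adj? x) xs)
          , ⊆.All-resp-⊆ τ (All.all-filter (adj? x) xs) ∷ c , cong suc l)
    , (λ p → let ys , τ , c , l = cl>0⇒Clique (suc s) xs p in ys , x ∷ʳ τ , c , l)
    ]′ (0<m+n⇒0<m⊎0<n (cl s (nbrs x xs)) c>0)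

  Clique-length≤ : ∀ {a xs} → Clique xs → cl (suc a) xs ≡ 0 → length xs ≤ a
  Clique-length≤ {a} p cl≡0 = ≮⇒≥ λ a<l →
    >⇒≢ (k≤n⇒0<nCk a<l) (≡.trans (sym (cl-Clique (suc a) p)) cl≡0)

  Clique-filter : ∀ {P : U.Pred V 0ℓ} (P? : U.Decidable P) {xs} → Clique xs → Clique (filter P? xs)
  Clique-filter = AllPairs.filter⁺

  clique-number : ∀ q xs → cl (suc q) xs ≡ 0 → ∃ λ a → a ≤ q × 0 < cl a xs × cl (suc a) xs ≡ 0
  clique-number q xs eq with cl q xs in eq′
  clique-number zero    xs eq | suc _ = zero , z≤n , z<s , eq
  clique-number (suc q) xs eq | suc _ = suc q , ≤-refl , subst (0 <_) (sym eq′) z<s , eq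
  clique-number (suc q) xs eq | zero with a , a≤q , p , e ← clique-number q xs eq′ =
    a , m≤n⇒m≤1+n a≤q , p , e

  module _ (symm : Symmetric Adj) where

    private
      cl-swap : ∀ s x y xs → cl s (x ∷ y ∷ xs) ≡ cl s (y ∷ x ∷ xs)
      cl-swap zero x y xs = refl
      cl-swap (suc s) x y xs with adj? x y | adj? y x
      ... | yes xy | no ¬yx = contradiction (symm xy) ¬yx
      ... | no ¬xy | yes yx = contradiction (symm yx) ¬xy
      ... | no _   | no _   = x+[y+z]≡y+[x+z] (cl s (nbrs x xs)) (cl s (nbrs y xs)) _
      cl-swap (suc zero) x y xs | yes _ | yes _ = refl
      -- Here `c` counts the cliques through both `x` and `y`, `a` and `b` those through exactly one
      -- of them, `d` those through neither.
      cl-swap (suc (suc s)) x y xs | yes _ | yes _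
        rewrite filter-comm (adj? y) (adj? x) xs = begin
        c + a + (b + d)     ≡⟨ +-assoc c a (b + d) ⟩
        c + (a + (b + d))   ≡⟨ cong (c +_) (x+[y+z]≡y+[x+z] a b d) ⟩
        c + (b + (a + d))   ≡⟨ +-assoc c b (a + d) ⟨
        c + b + (a + d)     ∎
        where
        open ≡-Reasoning
        a = cl (suc s) (nbrs x xs)
        b = cl (suc s) (nbrs y xs)
        c = cl s (nbrs x (nbrs y xs))
        d = cl (suc (suc s)) xs

    cl-↭ : ∀ s {xs ys} → xs ↭ ys → cl s xs ≡ cl s ys
    cl-↭ zero    _          = refl
    cl-↭ (suc s) refl       = refl
    cl-↭ (suc s) (prep x p) = cong₂ _+_ (cl-↭ s (filter-↭ (adj? x) p)) (cl-↭ (suc s) p)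
    cl-↭ (suc s) {x ∷ y ∷ xs} {_ ∷ _ ∷ ys} (swap x y p) = ≡.trans (cl-swap (suc s) x y xs)
      (cong₂ _+_ (cl-↭ s (filter-↭ (adj? y) (prep x p)))
                 (cong₂ _+_ (cl-↭ s (filter-↭ (adj? x) p)) (cl-↭ (suc s) p)))
    cl-↭ (suc s) (trans p q) = ≡.trans (cl-↭ (suc s) p) (cl-↭ (suc s) q)

    Clique-↭ : ∀ {xs ys} → xs ↭ ys → Clique xs → Clique ys
    Clique-↭ refl         ps                         = ps
    Clique-↭ (prep x p)   (px ∷ ps)                  = ↭.All-resp-↭ p px ∷ Clique-↭ p ps
    Clique-↭ (swap x y p) ((xy ∷ px) ∷ py ∷ ps)      =
      (symm xy ∷ ↭.All-resp-↭ p py) ∷ ↭.All-resp-↭ p px ∷ Clique-↭ p ps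
    Clique-↭ (trans p q)  ps                         = Clique-↭ q (Clique-↭ p ps)

module _ {V′ : Set} {Adj : Rel V 0ℓ} {Adj′ : Rel V′ 0ℓ}
         (adj? : Decidable Adj) (adj′? : Decidable Adj′) (f : V → V′)
         (pres : ∀ x y → Adj x y → Adj′ (f x) (f y)) (refl′ : ∀ x y → Adj′ (f x) (f y) → Adj x y) where

  private
    module G = Cliques adj?
    module H = Cliques adj′?

  nbrs-map : ∀ x ys → H.nbrs (f x) (map f ys) ≡ map f (G.nbrs x ys)
  nbrs-map x []       = refl
  nbrs-map x (y ∷ ys) with adj? x y | adj′? (f x) (f y)
  ... | yes _ | yes _ = cong (f y ∷_) (nbrs-map x ys)
  ... | no _  | no _  = nbrs-map x ys
  ... | yes a | no ¬b = contradiction (pres x y a) ¬b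
  ... | no ¬a | yes b = contradiction (refl′ x y b) ¬a

  cl-map : ∀ s xs → H.cl s (map f xs) ≡ G.cl s xs
  cl-map zero    xs       = refl
  cl-map (suc s) []       = refl
  cl-map (suc s) (x ∷ xs) = cong₂ _+_
    (≡.trans (cong (H.cl s) (nbrs-map x xs)) (cl-map s (G.nbrs x xs))) (cl-map (suc s) xs)

-- Extending cliques by the vertices of a fixed clique

-- W q s f = Σᵢ C(q ∸ i, s ∸ i) f i: the number of s-cliques when each of the f i
-- cliques of order i outside a given clique has q ∸ i common neighbours in it.
W : ℕ → ℕ → (ℕ → ℕ) → ℕ
W q zero    f = f 0
W q (suc s) f = (q C suc s) * f 0 + W (pred q) s (f ∘ suc)

W-mono-≤ : ∀ q s {f g} → (∀ i → f i ≤ g i) → W q s f ≤ W q s g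
W-mono-≤ q zero    f≤g = f≤g 0
W-mono-≤ q (suc s) f≤g =
  +-mono-≤ (*-monoʳ-≤ (q C suc s) (f≤g 0)) (W-mono-≤ (pred q) s (f≤g ∘ suc))

W-+ : ∀ q s f g → W q s (λ i → f i + g i) ≡ W q s f + W q s g
W-+ q zero    f g = refl
W-+ q (suc s) f g = begin
  c * (f 0 + g 0) + W p s (λ i → f (suc i) + g (suc i))
    ≡⟨ cong₂ _+_ (*-distribˡ-+ c (f 0) (g 0)) (W-+ p s (f ∘ suc) (g ∘ suc)) ⟩
  c * f 0 + c * g 0 + (W p s (f ∘ suc) + W p s (g ∘ suc))
    ≡⟨ +-interchange (c * f 0) _ _ _ ⟩
  W q (suc s) f + W q (suc s) g ∎
  where
  open ≡-Reasoning
  c = q C suc s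
  p = pred q

W-zero : ∀ q s → W q s (λ _ → 0) ≡ 0
W-zero q zero    = refl
W-zero q (suc s) rewrite *-zeroʳ (q C suc s) = W-zero (pred q) s

W-diag : ∀ q f → W (suc q) (suc q) f ≡ f 0 + W q q (f ∘ suc)
W-diag q f rewrite nCn≡1 (suc q) | *-identityˡ (f 0) = refl

-- For s = q every coefficient C(q ∸ i, q ∸ i) is 1, so no term with i ≤ q can hide a deficit.
W-diag-≡ : ∀ q {f g} → (∀ i → f i ≤ g i) → W q q f ≡ W q q g → ∀ i → i ≤ q → f i ≡ g i
W-diag-≡ zero    f≤g eq zero _ = eq
W-diag-≡ (suc q) {f} {g} f≤g eq = λ where
    zero    _         → +-≤-≡⇒≡ˡ (f≤g 0) rest≤ eq′
    (suc i) (s≤s i≤q) → W-diag-≡ q (f≤g ∘ suc) (+-≤-≡⇒≡ʳ (f≤g 0) rest≤ eq′) i i≤q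
  where
  rest≤ = W-mono-≤ q q (f≤g ∘ suc)
  eq′  = ≡.trans (sym (W-diag q f)) (≡.trans eq (W-diag q g))

module Extension {Adj : Rel V 0ℓ} (adj? : Decidable Adj) where

  open Cliques adj?

  -- The i-cliques of `b ∷ B` split by whether they contain `b`. Removing `b` from a clique lowers
  -- q, s and i together, which preserves q ∸ i and s ∸ i.
  W-∷ : ∀ q s b B → W q (suc s) (λ i → cl i (b ∷ B))
                  ≡ W (pred q) s (λ i → cl i (nbrs b B)) + W q (suc s) (λ i → cl i B)
  W-∷ q s b B = begin
    c + W (pred q) s (λ i → cl i (nbrs b B) + cl (suc i) B)
      ≡⟨ cong (c +_) (W-+ (pred q) s (λ i → cl i (nbrs b B)) (λ i → cl (suc i) B)) ⟩
    c + (w + w′)  ≡⟨ x+[y+z]≡y+[x+z] c w w′ ⟩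
    w + (c + w′)  ∎
    where
    open ≡-Reasoning
    c = (q C suc s) * 1
    w = W (pred q) s (λ i → cl i (nbrs b B))
    w′ = W (pred q) s (λ i → cl (suc i) B)

  -- An i-clique of `B` and its common neighbours in `A` form a clique of `B ++ A`, so it has at
  -- most a ∸ i of them, and at most `e` more in `E`. In the induction on `B`, passing to the
  -- neighbours of `b` lowers the forbidden order by one.
  cl-++≤W : ∀ s e a E A B → Clique A → length E ≤ e → cl (suc a) (B ++ A) ≡ 0 →
            cl s (B ++ E ++ A) ≤ W (e + a) s (λ i → cl i B)
  cl-++≤W zero    e a E A B _ _ _ = ≤-refl
  cl-++≤W (suc s) e a E A [] A! E≤e free = begin
    cl (suc s) (E ++ A)            ≤⟨ cl≤C (suc s) (E ++ A) ⟩
    length (E ++ A) C suc s        ≡⟨ cong (_C suc s) (length-++ E) ⟩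
    (length E + length A) C suc s  ≤⟨ C-monoˡ-≤ (suc s) (+-mono-≤ E≤e (Clique-length≤ A! free)) ⟩
    (e + a) C suc s                ≡⟨ *-identityʳ _ ⟨
    ((e + a) C suc s) * 1            ≤⟨ m≤m+n _ _ ⟩
    W (e + a) (suc s) (λ i → cl i []) ∎
    where open ≤-Reasoning
  -- The case a = 0 is impossible: the single vertex `b` would violate `free`.
  cl-++≤W (suc s) e (suc a) E A (b ∷ B) A! E≤e free = begin
    cl s (nbrs b (B ++ E ++ A)) + cl (suc s) (B ++ E ++ A)
      ≡⟨ cong (λ xs → cl s xs + cl (suc s) (B ++ E ++ A)) nbrs-++₃ ⟩
    cl s (nbrs b B ++ nbrs b E ++ nbrs b A) + cl (suc s) (B ++ E ++ A)
      ≤⟨ +-mono-≤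
           (cl-++≤W s e a (nbrs b E) (nbrs b A) (nbrs b B) (Clique-filter (adj? b) A!)
             (≤-trans (length-filter (adj? b) E) E≤e)
             (≡.trans (cong (cl (suc a)) (sym (filter-++ (adj? b) B A))) (m+n≡0⇒m≡0 _ free)))
           (cl-++≤W (suc s) e (suc a) E A B A! E≤e (m+n≡0⇒n≡0 (cl (suc a) (nbrs b (B ++ A))) free)) ⟩
    W (e + a) s (λ i → cl i (nbrs b B)) + W (e + suc a) (suc s) (λ i → cl i B)
      ≡⟨ cong (λ q → W (pred q) s (λ i → cl i (nbrs b B)) + W (e + suc a) (suc s) (λ i → cl i B)) (+-suc e a) ⟨
    W (pred (e + suc a)) s (λ i → cl i (nbrs b B)) + W (e + suc a) (suc s) (λ i → cl i B)
      ≡⟨ W-∷ (e + suc a) s b B ⟨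
    W (e + suc a) (suc s) (λ i → cl i (b ∷ B)) ∎
    where
    open ≤-Reasoning
    nbrs-++₃ : nbrs b (B ++ E ++ A) ≡ nbrs b B ++ nbrs b E ++ nbrs b A
    nbrs-++₃ = ≡.trans (filter-++ (adj? b) B (E ++ A)) (cong (nbrs b B ++_) (filter-++ (adj? b) E A))

  length≤1+nbrs : ∀ b A → length (non b A) ≤ 1 → length A ≤ suc (length (nbrs b A))
  length≤1+nbrs b A non≤1 = begin
    length A                              ≡⟨ length-filter-∁ (adj? b) A ⟩
    length (nbrs b A) + length (non b A)  ≤⟨ +-monoʳ-≤ _ non≤1 ⟩
    length (nbrs b A) + 1                 ≡⟨ +-comm _ 1 ⟩
    suc (length (nbrs b A))               ∎
    where open ≤-Reasoning

  -- Each vertex of an i-clique of `B` excludes at most one vertex of `A`, which leaves at least q ∸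
  -- i common neighbours, and these are pairwise adjacent.
  W≤cl-++ : ∀ s q A B → Clique A → q ≤ length A → All (λ b → length (non b A) ≤ 1) B →
            W q s (λ i → cl i B) ≤ cl s (B ++ A)
  W≤cl-++ zero    q A B  _ _ _ = ≤-refl
  W≤cl-++ (suc s) q A [] A! q≤A _ = begin
    (q C suc s) * 1 + W (pred q) s (λ _ → 0)  ≡⟨ cong₂ _+_ (*-identityʳ _) (W-zero (pred q) s) ⟩
    q C suc s + 0                           ≡⟨ +-identityʳ _ ⟩
    q C suc s                               ≤⟨ C-monoˡ-≤ (suc s) q≤A ⟩
    length A C suc s                        ≡⟨ cl-Clique (suc s) A! ⟨
    cl (suc s) A                            ∎
    where open ≤-Reasoning
  W≤cl-++ (suc s) q A (b ∷ B) A! q≤A (non≤1 ∷ ps) = begin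
    W q (suc s) (λ i → cl i (b ∷ B))
      ≡⟨ W-∷ q s b B ⟩
    W (pred q) s (λ i → cl i (nbrs b B)) + W q (suc s) (λ i → cl i B)
      ≤⟨ +-mono-≤
           (W≤cl-++ s (pred q) (nbrs b A) (nbrs b B) (Clique-filter (adj? b) A!)
             (pred-mono-≤ (≤-trans q≤A (length≤1+nbrs b A non≤1)))
             (All.map non-nbrs≤1 (All.filter⁺ (adj? b) ps)))
           (W≤cl-++ (suc s) q A B A! q≤A ps) ⟩
    cl s (nbrs b B ++ nbrs b A) + cl (suc s) (B ++ A)
      ≡⟨ cong (λ xs → cl s xs + cl (suc s) (B ++ A)) (filter-++ (adj? b) B A) ⟨
    cl (suc s) (b ∷ B ++ A) ∎
    where
    open ≤-Reasoning
    non-nbrs≤1 : ∀ {c} → length (non c A) ≤ 1 → length (non c (nbrs b A)) ≤ 1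
    non-nbrs≤1 {c} p = ≤-trans (⊆.length-mono-≤ (filter-mono-⊆ (¬? ∘ adj? c) (⊆.filter-⊆ (adj? b) A))) p

  private
    cl-++≤W-diag : ∀ q A B → Clique A → cl (suc q) (B ++ A) ≡ 0 → cl q (B ++ A) ≤ W q q (λ i → cl i B)
    cl-++≤W-diag q A B = λ A! → cl-++≤W q 0 q [] A B A! z≤n

    -- By `W-∷` both sides split into the cliques with and without `b`, and `cl-++≤W-diag` bounds
    -- each part separately.
    peel : ∀ q A b B → Clique A → cl (suc (suc q)) (b ∷ B ++ A) ≡ 0 →
           cl (suc q) (b ∷ B ++ A) ≡ W (suc q) (suc q) (λ i → cl i (b ∷ B)) →
           cl q (nbrs b B ++ nbrs b A) ≡ W q q (λ i → cl i (nbrs b B)) ×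
           cl (suc q) (B ++ A) ≡ W (suc q) (suc q) (λ i → cl i B)
    peel q A b B A! free eq = +-≤-≡⇒≡ˡ ≤₁ ≤₂ eq′ , +-≤-≡⇒≡ʳ ≤₁ ≤₂ eq′
      where
      ≤₁ = cl-++≤W-diag q (nbrs b A) (nbrs b B) (Clique-filter (adj? b) A!)
             (≡.trans (cong (cl (suc q)) (sym (filter-++ (adj? b) B A))) (m+n≡0⇒m≡0 _ free))
      ≤₂ = cl-++≤W-diag (suc q) A B A! (m+n≡0⇒n≡0 (cl (suc q) (nbrs b (B ++ A))) free)
      eq′ = ≡.trans (cong (λ xs → cl q xs + cl (suc q) (B ++ A)) (sym (filter-++ (adj? b) B A)))
                    (≡.trans eq (W-∷ (suc q) q b B))

    -- `peel` passes the equality down to the empty list. There the term i = 0 equals 1, so `A` must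
    -- contain a set of q vertices.
    q≤∣A∣ : ∀ q A B → Clique A → cl (suc q) (B ++ A) ≡ 0 → cl q (B ++ A) ≡ W q q (λ i → cl i B) → q ≤ length A
    q≤∣A∣ zero    A B       _ _ _ = z≤n
    q≤∣A∣ (suc q) A []      A! _ eq = 0<nCk⇒k≤n (begin
      1                                       ≤⟨ m≤m+n 1 _ ⟩
      1 + W q q (λ i → cl (suc i) [])         ≡⟨ W-diag q (λ i → cl i []) ⟨
      W (suc q) (suc q) (λ i → cl i [])       ≡⟨ eq ⟨
      cl (suc q) A                            ≡⟨ cl-Clique (suc q) A! ⟩
      length A C suc q                        ∎)
      where open ≤-Reasoning
    q≤∣A∣ (suc q) A (b ∷ B) A! free eq = q≤∣A∣ (suc q) A B A!
      (m+n≡0⇒n≡0 (cl (suc q) (nbrs b (B ++ A))) free) (proj₂ (peel q A b B A! free eq))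

  -- For s = q the inequality cl-++≤W says that a j-clique of B extends in at
  -- most one way by q ∸ j vertices of A; the case j = 1 of equality is used.
  cl-++≡W⇒nbrs : ∀ q A B → Clique A → cl (suc q) (B ++ A) ≡ 0 → cl q (B ++ A) ≡ W q q (λ i → cl i B) →
                 All (λ b → q ≤ suc (length (nbrs b A))) B
  cl-++≡W⇒nbrs q       A []      _  _    _  = []
  cl-++≡W⇒nbrs (suc q) A (b ∷ B) A! free eq =
    s≤s (q≤∣A∣ q (nbrs b A) (nbrs b B) (Clique-filter (adj? b) A!)
          (≡.trans (cong (cl (suc q)) (sym (filter-++ (adj? b) B A))) (m+n≡0⇒m≡0 _ free))
          (proj₁ (peel q A b B A! free eq)))
    ∷ cl-++≡W⇒nbrs (suc q) A B A! (m+n≡0⇒n≡0 (cl (suc q) (nbrs b (B ++ A))) free)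
        (proj₂ (peel q A b B A! free eq))

-- Clique counts of Turán graphs and Zykov's theorem

applyUpTo-+ : ∀ (f : ℕ → V) m n → applyUpTo f (m + n) ≡ applyUpTo f m ++ applyUpTo (f ∘ (m +_)) n
applyUpTo-+ f zero    n = refl
applyUpTo-+ f (suc m) n = cong (f 0 ∷_) (applyUpTo-+ (f ∘ suc) m n)

applyUpTo-mono-⊆ : ∀ (f : ℕ → V) {m n} → m ≤ n → applyUpTo f m ⊆ applyUpTo f n
applyUpTo-mono-⊆ f z≤n       = ⊆.[]⊆-universal _
applyUpTo-mono-⊆ f (s≤s m≤n) = refl ∷ applyUpTo-mono-⊆ (f ∘ suc) m≤n

Unique-constant⇒length≤1 : ∀ {c : V} {xs} → Unique xs → All (_≡ c) xs → length xs ≤ 1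
Unique-constant⇒length≤1 []      _ = z≤n
Unique-constant⇒length≤1 ([] ∷ _) _ = ≤-refl
Unique-constant⇒length≤1 ((x≢y ∷ _) ∷ _) (refl ∷ refl ∷ _) = contradiction refl x≢y

^-distribʳ-* : ∀ n l m → (l * m) ^ n ≡ l ^ n * m ^ n
^-distribʳ-* zero    l m = refl
^-distribʳ-* (suc n) l m = ≡.trans (cong (l * m *_) (^-distribʳ-* n l m)) ([m*n]*[o*p]≡[m*o]*[n*p] l m (l ^ n) (m ^ n))

module _ (t : ℕ) where

  private
    q : ℕ
    q = suc t

  TuránAdj : Rel ℕ 0ℓ
  TuránAdj i j = i % q ≢ j % q

  turánAdj? : Decidable TuránAdj
  turánAdj? i j = ¬? (i % q ≟ j % q)

  private
    module T = Cliques turánAdj?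

  -- The number of copies of K s in T_q(N), where q = 1 + t.
  z : ℕ → ℕ → ℕ
  z N s = T.cl s (upTo N)

  z-monoˡ-≤ : ∀ {M N} s → M ≤ N → z M s ≤ z N s
  z-monoˡ-≤ s M≤N = T.cl-mono-⊆ s (applyUpTo-mono-⊆ id M≤N)

  upTo-Clique : ∀ {N} → N ≤ q → T.Clique (upTo N)
  upTo-Clique {N} N≤q = AllPairs.applyUpTo⁺₁ id N λ {i} {j} i<j j<N i≡j → <⇒≢ i<j (begin
    i      ≡⟨ m<n⇒m%n≡m (<-≤-trans (<-trans i<j j<N) N≤q) ⟨
    i % q  ≡⟨ i≡j ⟩
    j % q  ≡⟨ m<n⇒m%n≡m (<-≤-trans j<N N≤q) ⟩
    j      ∎)
    where open ≡-Reasoning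

  z-small : ∀ {N} s → N ≤ q → z N s ≡ N C s
  z-small {N} s N≤q = ≡.trans (T.cl-Clique s (upTo-Clique N≤q)) (cong (_C s) (length-upTo N))

  [q+i]%q≡i%q : ∀ i → (q + i) % q ≡ i % q
  [q+i]%q≡i%q i = ≡.trans (cong (_% q) (+-comm q i)) ([m+n]%n≡m%n i q)

  -- The numbers below q represent each residue class once, and a shift by q preserves residues. So
  -- removing one vertex from each part leaves T_q(N), and each remaining vertex has at most one
  -- non-neighbour among the removed ones.
  W≤z : ∀ N s → W q s (z N) ≤ z (q + N) s
  W≤z N s = begin
    W q s (z N)                                         ≤⟨ W-mono-≤ q s (λ i → ≤-reflexive (sym (shifted i))) ⟩
    W q s (λ i → T.cl i B)                              ≤⟨ Extension.W≤cl-++ turánAdj? s q A B (upTo-Clique ≤-refl)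
                                                            (≤-reflexive (sym (length-upTo q))) (All.universal non≤1 B) ⟩
    T.cl s (B ++ A)                                     ≡⟨ T.cl-↭ (_∘ sym) s (↭.++-comm B A) ⟩
    T.cl s (A ++ B)                                     ≡⟨ cong (T.cl s) (applyUpTo-+ id q N) ⟨
    z (q + N) s                                         ∎
    where
    open ≤-Reasoning
    A = upTo q
    B = applyUpTo (q +_) N
    shifted : ∀ i → T.cl i B ≡ z N i
    shifted i = ≡.trans (cong (T.cl i) (sym (map-upTo (q +_) N)))
      (cl-map turánAdj? turánAdj? (q +_)
        (λ x y → subst₂ _≢_ (sym ([q+i]%q≡i%q x)) (sym ([q+i]%q≡i%q y)))
        (λ x y → subst₂ _≢_ ([q+i]%q≡i%q x) ([q+i]%q≡i%q y)) i (upTo N))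
    non≤1 : ∀ b → length (T.non b A) ≤ 1
    non≤1 b = Unique-constant⇒length≤1 (Unique.filter⁺ (¬? ∘ turánAdj? b) (Unique.upTo⁺ q))
      (All.zipWith (λ {x} (x<q , ¬adj) → ≡.trans (sym (m<n⇒m%n≡m x<q)) (sym (decidable-stable (b % q ≟ x % q) ¬adj)))
        ( All.filter⁺ (¬? ∘ turánAdj? b) (All.applyUpTo⁺₁ id q id)
        , All.all-filter (¬? ∘ turánAdj? b) A))

  module Zykov {Adj : Rel V 0ℓ} (adj? : Decidable Adj) (symm : Symmetric Adj) where

    open Cliques adj?
    open Extension adj?

    split-Clique : ∀ {a xs} → 0 < cl a xs → ∃₂ λ A R → xs ↭ A ++ R × Clique A × length A ≡ a
    split-Clique {a} {xs} pos with A , τ , A! , l ← cl>0⇒Clique a xs pos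
                              with R , p ← ⊆⇒↭ τ = A , R , p , A! , l

    private
      zykov′ : ∀ xs → Acc _<_ (length xs) → cl (suc q) xs ≡ 0 → ∀ s → cl s xs ≤ z (length xs) s
      zykov′ xs (acc rec) free s with length xs ≤? q
      ... | yes l≤q = ≤-trans (cl≤C s xs) (≤-reflexive (sym (z-small s l≤q)))
      ... | no  l≰q
        with a , a≤q , pos , a-free ← clique-number q xs free
        with A , R , p , A! , refl ← split-Clique {a} pos
        = begin
        cl s xs                               ≡⟨ cl-↭ symm s p′ ⟩
        cl s (B ++ E ++ A)                    ≤⟨ cl-++≤W s e (length A) E A B A! E≤e
                                                   (n≤0⇒n≡0 (≤-trans (cl-B++A≤ (suc (length A))) (≤-reflexive a-free))) ⟩
        W (e + length A) s (λ i → cl i B)     ≡⟨ cong (λ m → W m s (λ i → cl i B)) (m∸n+n≡m a≤q) ⟩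
        W q s (λ i → cl i B)                  ≤⟨ W-mono-≤ q s (zykov′ B (rec B<xs) B-free) ⟩
        W q s (z (length B))                  ≤⟨ W≤z (length B) s ⟩
        z (q + length B) s                    ≡⟨ cong (λ m → z m s) q+B≡xs ⟩
        z (length xs) s                       ∎
        where
        open ≤-Reasoning
        -- Exactly q vertices are removed, so that `B` is as large as the Turán graph in `W≤z`.
        -- Clique-freeness is used only for `B ++ A`, hence `E` may be any vertices.
        e = q ∸ length A
        E = take e R
        B = drop e R
        R≡ : length xs ≡ length A + length R
        R≡ = ≡.trans (↭.↭-length p) (length-++ A)
        p′ : xs ↭ B ++ E ++ A
        p′ = ↭-trans p (↭-trans (↭.++-comm A R) (↭-trans
          (↭-reflexive (cong (_++ A) (sym (take++drop≡id e R))))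
          (↭-trans (↭.++⁺ʳ A (↭.++-comm E B)) (↭-reflexive (++-assoc B E A)))))
        E≤e : length E ≤ e
        E≤e = ≤-trans (≤-reflexive (length-take e R)) (m⊓n≤m e (length R))
        cl-B++A≤ : ∀ i → cl i (B ++ A) ≤ cl i xs
        cl-B++A≤ i = ≤-trans (cl-mono-⊆ i (⊆.++⁺ {as = B} ⊆-refl (⊆.++⁺ˡ E (⊆-refl {x = A}))))
                             (≤-reflexive (cl-↭ symm i (↭-sym p′)))
        B-free : cl (suc q) B ≡ 0
        B-free = n≤0⇒n≡0 (≤-trans (cl-mono-⊆ (suc q) (⊆.++⁺ʳ A (⊆-refl {x = B})))
                           (≤-trans (cl-B++A≤ (suc q)) (≤-reflexive free)))
        q+B≡xs : q + length B ≡ length xs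
        q+B≡xs = begin-equality
          q + length B                       ≡⟨ cong (q +_) (length-drop e R) ⟩
          q + (length R ∸ e)                 ≡⟨ cong (_+ (length R ∸ e)) (m+[n∸m]≡n a≤q) ⟨
          length A + e + (length R ∸ e)      ≡⟨ +-assoc (length A) e _ ⟩
          length A + (e + (length R ∸ e))    ≡⟨ cong (length A +_) (m+[n∸m]≡n e≤R) ⟩
          length A + length R                ≡⟨ R≡ ⟨
          length xs                          ∎
          where
          e≤R : e ≤ length R
          e≤R = m≤n+o⇒m∸n≤o q (length A) (≤-trans (<⇒≤ (≰⇒> l≰q)) (≤-reflexive R≡))
        B<xs : length B < length xs
        B<xs = <-≤-trans (m<n+m (length B) z<s) (≤-reflexive q+B≡xs)

    zykov : ∀ {xs} → cl (suc q) xs ≡ 0 → ∀ s → cl s xs ≤ z (length xs) s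
    zykov {xs} = zykov′ xs (<-wellFounded _)

  -- Growth of the clique counts of Turán graphs

  private
    y : ℕ → ℕ → ℕ
    y a = z (a * q)

    f[s]≤W : ∀ p s f → f s ≤ W p s f
    f[s]≤W p zero    f = ≤-refl
    f[s]≤W p (suc s) f = ≤-trans (f[s]≤W (pred p) s (f ∘ suc)) (m≤n+m _ _)

    -- The last two terms have coefficients p ∸ s, which is positive, and 1.
    f[s]+f[1+s]≤W : ∀ p s f → s < p → f s + f (suc s) ≤ W p (suc s) f
    f[s]+f[1+s]≤W p zero f 0<p = +-monoˡ-≤ (f 1) (≤-trans (≤-reflexive (sym (*-identityˡ (f 0))))
      (*-monoˡ-≤ (f 0) (k≤n⇒0<nCk 0<p)))
    f[s]+f[1+s]≤W (suc p) (suc s) f (s≤s s<p) = ≤-trans (f[s]+f[1+s]≤W p s (f ∘ suc) s<p) (m≤n+m _ ((suc p C suc (suc s)) * f 0))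

    -- Adding one vertex to every part extends each old clique of order s < q by a new vertex in a
    -- part that it misses, so each of the `b` steps gains at least `y a s` cliques.
    y-step : ∀ b a s → s < q → b * y a s ≤ y (b + a) (suc s)
    y-step zero    a s _   = z≤n
    y-step (suc b) a s s<q = begin
      y a s + b * y a s                     ≤⟨ +-mono-≤ (z-monoˡ-≤ s (*-monoˡ-≤ q (m≤n+m a b))) (y-step b a s s<q) ⟩
      y (b + a) s + y (b + a) (suc s)       ≤⟨ f[s]+f[1+s]≤W q s (y (b + a)) s<q ⟩
      W q (suc s) (y (b + a))               ≤⟨ W≤z ((b + a) * q) (suc s) ⟩
      y (suc b + a) (suc s)                 ∎
      where open ≤-Reasoning

    -- `s` rounds of `b` such steps: each round raises the order by one and contributes a factor
    -- `b`.
    b^s≤y : ∀ b s → s ≤ q → b ^ s ≤ y (s * b) s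
    b^s≤y b zero    _   = ≤-refl
    b^s≤y b (suc s) s<q = ≤-trans (*-monoʳ-≤ b (b^s≤y b s (<⇒≤ s<q))) (y-step b (s * b) s s<q)

  z-growth : ∀ M → ∃ λ n₀ → ∀ n → n₀ ≤ n → M * n ^ t < z n q
  z-growth M = suc M′ * c , bound
    where
    -- At order q, `b^s≤y` takes q parts of size `q * b`, so `b` is chosen as n / (q * q). The
    -- factor in `M′` absorbs the loss in n ≤ 2 c b.
    c = q * q
    M′ = M * (2 * c) ^ t
    bound : ∀ n → suc M′ * c ≤ n → M * n ^ t < z n q
    bound n n₀≤n = begin-strict
      M * n ^ t                     ≤⟨ *-monoʳ-≤ M (^-monoˡ-≤ t n≤2cb) ⟩
      M * (2 * c * b) ^ t           ≡⟨ cong (M *_) (^-distribʳ-* t (2 * c) b) ⟩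
      M * ((2 * c) ^ t * b ^ t)     ≡⟨ *-assoc M _ _ ⟨
      M′ * b ^ t                    <⟨ *-monoˡ-< (b ^ t) {{m^n≢0 b t}} M′<b ⟩
      b ^ q                         ≤⟨ b^s≤y b q ≤-refl ⟩
      z (q * b * q) q               ≤⟨ z-monoˡ-≤ q qbq≤n ⟩
      z n q                         ∎
      where
      open ≤-Reasoning
      b = n / c
      M′<b : M′ < b
      M′<b = ≤-trans (≤-reflexive (sym (m*n/n≡m (suc M′) c))) (/-monoˡ-≤ c n₀≤n)
      instance
        b≢0 : NonZero b
        b≢0 = >-nonZero (≤-<-trans z≤n M′<b)
      qbq≤n : q * b * q ≤ n
      qbq≤n = ≤-trans (≤-reflexive (≡.trans (cong (_* q) (*-comm q b)) (*-assoc b q q))) (m/n*n≤m n c)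
      n≤2cb : n ≤ 2 * c * b
      n≤2cb = begin
        n                ≡⟨ m≡m%n+[m/n]*n n c ⟩
        n % c + b * c    ≤⟨ +-monoˡ-≤ (b * c) (<⇒≤ (m%n<n n c)) ⟩
        c + b * c        ≤⟨ +-monoˡ-≤ (b * c) (m≤n*m c b) ⟩
        b * c + b * c    ≡⟨ cong (b * c +_) (+-identityʳ (b * c)) ⟨
        2 * (b * c)      ≡⟨ cong (2 *_) (*-comm b c) ⟩
        2 * (c * b)      ≡⟨ *-assoc 2 c b ⟨
        2 * c * b        ∎

-- Uniqueness in Zykov's theorem

⊆-length-≡ : ∀ {xs ys : List V} → xs ⊆ ys → length xs ≡ length ys → xs ≡ ys
⊆-length-≡ []         _  = refl
⊆-length-≡ (y ∷ʳ τ)   eq = contradiction eq (<⇒≢ (s≤s (⊆.length-mono-≤ τ)))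
⊆-length-≡ (refl ∷ τ) eq = cong (_ ∷_) (⊆-length-≡ τ (suc-injective eq))

Unique-⊆⇒↭ : ∀ {xs ys : List V} → Unique xs → All (_∈ ys) xs → ∃ λ zs → ys ↭ xs ++ zs
Unique-⊆⇒↭ {ys = ys} [] [] = ys , ↭-refl
Unique-⊆⇒↭ {xs = x ∷ xs} (x∉xs ∷ xs!) (x∈ys ∷ xs⊆ys)
  with us , vs , refl ← ∈-∃++ x∈ys
  with zs , p ← Unique-⊆⇒↭ {ys = us ++ vs} xs! (All.zipWith (λ (x≢y , y∈ys) →
         case ↭.∈-resp-↭ (↭.shift x us vs) y∈ys of λ where
           (here refl) → contradiction refl x≢y
           (there y∈)  → y∈) (x∉xs , xs⊆ys))
  = zs , ↭-trans (↭.shift x us vs) (prep x p)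

-- The sequence that lists xs first and then follows g.
glue : List V → (ℕ → V) → ℕ → V
glue []       g i       = g i
glue (x ∷ xs) g zero    = x
glue (x ∷ xs) g (suc i) = glue xs g i

glue-length+ : ∀ (xs : List V) g j → glue xs g (length xs + j) ≡ g j
glue-length+ []       g j = refl
glue-length+ (x ∷ xs) g j = glue-length+ xs g j

applyUpTo-glue : ∀ (xs : List V) g n → applyUpTo (glue xs g) (length xs + n) ≡ xs ++ applyUpTo g n
applyUpTo-glue []       g n = refl
applyUpTo-glue (x ∷ xs) g n = cong (x ∷_) (applyUpTo-glue xs g n)

glue-applyUpTo-++ : ∀ (h : ℕ → V) m ys g {i} → i < m → glue (applyUpTo h m ++ ys) g i ≡ h i
glue-applyUpTo-++ h (suc m) ys g {zero}  _         = refl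
glue-applyUpTo-++ h (suc m) ys g {suc i} (s≤s i<m) = glue-applyUpTo-++ (h ∘ suc) m ys g i<m

∈⇒glue : ∀ {x : V} {xs} g → x ∈ xs → ∃ λ i → i < length xs × glue xs g i ≡ x
∈⇒glue g (here refl) = zero , z<s , refl
∈⇒glue g (there x∈)  = let i , i<l , eq = ∈⇒glue g x∈ in suc i , s≤s i<l , eq

glue-∈ : ∀ (xs : List V) g {i} → i < length xs → glue xs g i ∈ xs
glue-∈ (x ∷ xs) g {zero}  _         = here refl
glue-∈ (x ∷ xs) g {suc i} (s≤s i<l) = there (glue-∈ xs g i<l)

AllPairs-glue : ∀ {R : Rel V 0ℓ} {xs} g → AllPairs R xs → ∀ {i j} → i < j → j < length xs →
                R (glue xs g i) (glue xs g j)
AllPairs-glue {xs = x ∷ xs} g (px ∷ _) {zero}  {suc j} _         (s≤s j<l) = All.lookup px (glue-∈ xs g j<l)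
AllPairs-glue               g (_ ∷ ps) {suc i} {suc j} (s≤s i<j) (s≤s j<l) = AllPairs-glue g ps i<j j<l

singleton⊆applyUpTo : ∀ (f : ℕ → V) {i n} → i < n → f i ∷ [] ⊆ applyUpTo f n
singleton⊆applyUpTo f {zero}  (s≤s i<n) = refl ∷ ⊆.[]⊆-universal _
singleton⊆applyUpTo f {suc i} (s≤s i<n) = f 0 ∷ʳ singleton⊆applyUpTo (f ∘ suc) i<n

pair⊆applyUpTo : ∀ (f : ℕ → V) {i j n} → i < j → j < n → f i ∷ f j ∷ [] ⊆ applyUpTo f n
pair⊆applyUpTo f {zero}  {suc j} _         (s≤s j<n) = refl ∷ singleton⊆applyUpTo (f ∘ suc) j<n
pair⊆applyUpTo f {suc i} {suc j} (s≤s i<j) (s≤s j<n) = f 0 ∷ʳ pair⊆applyUpTo (f ∘ suc) i<j j<n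

module ZykovUniqueness (t : ℕ) {Adj : Rel V 0ℓ} (adj? : Decidable Adj)
                       (symm : Symmetric Adj) (irrefl : Irreflexive _≡_ Adj) where

  open Cliques adj?
  open Extension adj?
  open Zykov t adj? symm

  private
    q : ℕ
    q = suc t

  -- A labelling of the vertices by 0, ..., N - 1 under which adjacency is decided by residues. It
  -- is total on ℕ so that `glue` can prolong it; values beyond the length are arbitrary.
  IsTurán : List V → Set
  IsTurán xs = ∃ λ (f : ℕ → V) → applyUpTo f (length xs) ↭ xs ×
    (∀ {i j} → i < length xs → j < length xs →
      (Adj (f i) (f j) → TuránAdj t i j) × (TuránAdj t i j → Adj (f i) (f j)))

  private
    <q⇒%≡ : ∀ {i} → i < q → i % q ≡ i
    <q⇒%≡ = m<n⇒m%n≡m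

    glue-Clique-injective : ∀ {xs} g → Clique xs → ∀ {i j} → i < length xs → j < length xs →
                            glue xs g i ≡ glue xs g j → i ≡ j
    glue-Clique-injective g xs! {i} {j} i<l j<l eq with <-cmp i j
    ... | tri< i<j _ _ = contradiction (AllPairs-glue g xs! i<j j<l) (irrefl eq)
    ... | tri≈ _ i≡j _ = i≡j
    ... | tri> _ _ j<i = contradiction (AllPairs-glue g xs! j<i i<l) (irrefl (sym eq))

    Clique-turán : ∀ {xs} g → Clique xs → length xs ≤ q → ∀ {i j} → i < length xs → j < length xs →
      (Adj (glue xs g i) (glue xs g j) → TuránAdj t i j) × (TuránAdj t i j → Adj (glue xs g i) (glue xs g j))
    Clique-turán {xs} g xs! l≤q {i} {j} i<l j<l = to , from
      where
      to : Adj (glue xs g i) (glue xs g j) → TuránAdj t i j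
      to a eq = irrefl (cong (glue xs g)
        (≡.trans (sym (<q⇒%≡ (<-≤-trans i<l l≤q))) (≡.trans eq (<q⇒%≡ (<-≤-trans j<l l≤q))))) a
      from : TuránAdj t i j → Adj (glue xs g i) (glue xs g j)
      from i≢j with <-cmp i j
      ... | tri< i<j _ _ = AllPairs-glue g xs! i<j j<l
      ... | tri≈ _ eq _  = contradiction (cong (_% q) eq) i≢j
      ... | tri> _ _ j<i = symm (AllPairs-glue g xs! j<i i<l)

  -- A q-clique A and a Turán graph on the rest, listed as f 0, …, f (M - 1),
  -- where every f j misses exactly one vertex φ j of A.  The vertices of A are
  -- listed so that the residue class of j contains φ j.
  module _ {A : List V} (A! : Clique A) (∣A∣≡q : length A ≡ q) (M : ℕ) (f : ℕ → V)
           (turán : ∀ {i j} → i < M → j < M →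
             (Adj (f i) (f j) → TuránAdj t i j) × (TuránAdj t i j → Adj (f i) (f j)))
           (free : cl (suc q) (applyUpTo f M ++ A) ≡ 0)
           (many : ∀ {j} → j < M → q ≤ suc (length (nbrs (f j) A))) where

    private
      Clique≤q : ∀ {C D} → C ⊆ applyUpTo f M → D ⊆ A → Clique (C ++ D) → length (C ++ D) ≤ q
      Clique≤q τ σ p = Clique-length≤ p (n≤0⇒n≡0 (≤-trans (cl-mono-⊆ (suc q) (⊆.++⁺ τ σ)) (≤-reflexive free)))

      -- The head of `non (f j) A`, a list that `non≡1` shows to be a singleton; `f` is only a
      -- filler that makes the head total.
      φ : ℕ → V
      φ j = glue (non (f j) A) f 0

      nbrs<q : ∀ {j} → j < M → length (nbrs (f j) A) < q
      nbrs<q {j} j<M = Clique≤q (singleton⊆applyUpTo f j<M) (⊆.filter-⊆ (adj? (f j)) A)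
        (All.all-filter (adj? (f j)) A ∷ Clique-filter (adj? (f j)) A!)

      non≡1 : ∀ {j} → j < M → length (non (f j) A) ≡ 1
      non≡1 {j} j<M = +-cancelˡ-≡ t _ _ (begin-equality
        t + length (non (f j) A)
          ≡⟨ cong (_+ length (non (f j) A)) (≤-antisym (s≤s⁻¹ (many j<M)) (s≤s⁻¹ (nbrs<q j<M))) ⟩
        length (nbrs (f j) A) + length (non (f j) A)  ≡⟨ length-filter-∁ (adj? (f j)) A ⟨
        length A                                      ≡⟨ ∣A∣≡q ⟩
        suc t                                         ≡⟨ +-comm 1 t ⟩
        t + 1                                         ∎)
        where open ≤-Reasoning

      non≡[φ] : ∀ {j} → j < M → non (f j) A ≡ φ j ∷ []
      non≡[φ] {j} j<M with non (f j) A | non≡1 j<M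
      ... | x ∷ [] | _ = refl

      φ-∈ : ∀ {j} → j < M → φ j ∈ A × ¬ Adj (f j) (φ j)
      φ-∈ {j} j<M = ∈-filter⁻ (¬? ∘ adj? (f j)) (subst (φ j ∈_) (sym (non≡[φ] j<M)) (here refl))

      φ-unique : ∀ {j a} → j < M → a ∈ A → ¬ Adj (f j) a → a ≡ φ j
      φ-unique {j} {a} j<M a∈A ¬adj
        with here eq ← subst (a ∈_) (non≡[φ] j<M) (∈-filter⁺ (¬? ∘ adj? (f j)) a∈A ¬adj) = eq

      -- If adjacent `f i` and `f j` missed the same vertex of `A`, then they and the other q - 1
      -- vertices would form a clique of order q + 1.
      φ-<-≢ : ∀ {i j} → i < j → j < M → Adj (f i) (f j) → φ i ≢ φ j
      φ-<-≢ {i} {j} i<j j<M adj φi≡φj = <⇒≱ (s≤s (many i<M)) (Clique≤q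
          (pair⊆applyUpTo f i<j j<M) (⊆.filter-⊆ (adj? (f i)) A)
          ((adj ∷ All.all-filter (adj? (f i)) A) ∷ All.tabulate fj-adj ∷ Clique-filter (adj? (f i)) A!))
        where
        i<M = <-trans i<j j<M
        fj-adj : ∀ {a} → a ∈ nbrs (f i) A → Adj (f j) a
        fj-adj {a} a∈ = decidable-stable (adj? (f j) a) λ ¬adj →
          let a∈A , fi-a = ∈-filter⁻ (adj? (f i)) a∈
          in proj₂ (φ-∈ i<M) (subst (Adj (f i)) (≡.trans (φ-unique j<M a∈A ¬adj) (sym φi≡φj)) fi-a)

      φ-≢ : ∀ {i j} → i < M → j < M → TuránAdj t i j → φ i ≢ φ j
      φ-≢ {i} {j} i<M j<M i≢j with <-cmp i j
      ... | tri< i<j _ _ = φ-<-≢ i<j j<M (proj₂ (turán i<M j<M) i≢j)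
      ... | tri≈ _ eq _  = contradiction (cong (_% q) eq) i≢j
      ... | tri> _ _ j<i = φ-<-≢ j<i i<M (proj₂ (turán j<M i<M) (i≢j ∘ sym)) ∘ sym

      -- The first `m` vertices f j lie in different classes, so their missed vertices are distinct
      -- and can take the first places of `A′`. If M < q, the rest of `A` follows in any order.
      m = M ⊓ q

      <m⇒<M : ∀ {i} → i < m → i < M
      <m⇒<M i<m = <-≤-trans i<m (m⊓n≤m M q)

      <m⇒<q : ∀ {i} → i < m → i < q
      <m⇒<q i<m = <-≤-trans i<m (m⊓n≤n M q)

      abstract
        ordered : ∃ λ zs → A ↭ applyUpTo φ m ++ zs
        ordered = Unique-⊆⇒↭
          (AllPairs.applyUpTo⁺₁ φ m λ i<j j<m → let i<m = <-trans i<j j<m in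
            φ-≢ (<m⇒<M i<m) (<m⇒<M j<m)
              (subst₂ _≢_ (sym (<q⇒%≡ (<m⇒<q i<m))) (sym (<q⇒%≡ (<m⇒<q j<m))) (<⇒≢ i<j)))
          (All.applyUpTo⁺₁ φ m λ i<m → proj₁ (φ-∈ (<m⇒<M i<m)))

      A′ = applyUpTo φ m ++ proj₁ ordered

      ∣A′∣≡q : length A′ ≡ q
      ∣A′∣≡q = ≡.trans (sym (↭.↭-length (proj₂ ordered))) ∣A∣≡q

      A′! : Clique A′
      A′! = Clique-↭ symm (proj₂ ordered) A!

      <q⇒<A′ : ∀ {i} → i < q → i < length A′
      <q⇒<A′ = subst (_ <_) (sym ∣A′∣≡q)

    extended : ℕ → V
    extended = glue A′ f

    private
      extended-∈ : ∀ {i} → i < q → extended i ∈ A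
      extended-∈ i<q = ↭.∈-resp-↭ (↭-sym (proj₂ ordered)) (glue-∈ A′ f (<q⇒<A′ i<q))

      extended-q+ : ∀ j → extended (q + j) ≡ f j
      extended-q+ j = subst (λ n → extended (n + j) ≡ f j) ∣A′∣≡q (glue-length+ A′ f j)

      -- For j ≥ q, `φ j` stands at some place i < q of `A′`, and so does `φ i`, since i < q ≤ j <
      -- M. Different residues of i and j would contradict `φ-≢`.
      φ≡extended : ∀ {j} → j < M → φ j ≡ extended (j % q)
      φ≡extended {j} j<M with j <? q
      ... | yes j<q = sym (≡.trans (cong extended (<q⇒%≡ j<q))
                        (glue-applyUpTo-++ φ m (proj₁ ordered) f (⊓-glb j<M j<q)))
      ... | no  j≮q
        with i , i<l , eq ← ∈⇒glue f (↭.∈-resp-↭ (proj₂ ordered) (proj₁ (φ-∈ j<M)))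
        = ≡.trans (sym eq) (cong extended (≡.trans (sym (<q⇒%≡ i<q)) i%q≡j%q))
        where
        i<q = subst (i <_) ∣A′∣≡q i<l
        i<M = <-trans i<q (≤-<-trans (≮⇒≥ j≮q) j<M)
        i%q≡j%q : i % q ≡ j % q
        i%q≡j%q = decidable-stable (i % q ≟ j % q) λ i≢j → φ-≢ i<M j<M i≢j
          (≡.trans (sym (glue-applyUpTo-++ φ m (proj₁ ordered) f (⊓-glb i<M i<q))) eq)

      cross : ∀ {i j} → i < q → j < M →
              (Adj (f j) (extended i) → TuránAdj t j i) × (TuránAdj t j i → Adj (f j) (extended i))
      cross {i} {j} i<q j<M = to , from
        where
        to : Adj (f j) (extended i) → TuránAdj t j i
        to a j≡i = proj₂ (φ-∈ j<M) (subst (Adj (f j))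
          (sym (≡.trans (φ≡extended j<M) (cong extended (≡.trans j≡i (<q⇒%≡ i<q))))) a)
        from : TuránAdj t j i → Adj (f j) (extended i)
        from j≢i = decidable-stable (adj? (f j) (extended i)) λ ¬adj → j≢i
          (≡.trans (sym (glue-Clique-injective f A′! (<q⇒<A′ i<q) (<q⇒<A′ (m%n<n j q))
              (≡.trans (φ-unique j<M (extended-∈ i<q) ¬adj) (φ≡extended j<M))))
            (sym (<q⇒%≡ i<q)))

      split-<q : ∀ {i} → i < q + M → i < q ⊎ ∃ λ i′ → i ≡ q + i′ × i′ < M
      split-<q {i} i<N with i <? q
      ... | yes i<q = inj₁ i<q
      ... | no  i≮q = inj₂ (i ∸ q , sym (m+[n∸m]≡n (≮⇒≥ i≮q)) , +-cancelˡ-< q _ _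
                        (subst (_< q + M) (sym (m+[n∸m]≡n (≮⇒≥ i≮q))) i<N))

    extended-turán : ∀ {i j} → i < q + M → j < q + M →
      (Adj (extended i) (extended j) → TuránAdj t i j) × (TuránAdj t i j → Adj (extended i) (extended j))
    extended-turán {i} {j} i<N j<N with split-<q i<N | split-<q j<N
    ... | inj₁ i<q | inj₁ j<q = Clique-turán f A′! (≤-reflexive ∣A′∣≡q) (<q⇒<A′ i<q) (<q⇒<A′ j<q)
    ... | inj₁ i<q | inj₂ (j′ , refl , j<M)
      rewrite extended-q+ j′ | [q+i]%q≡i%q t j′ =
        let to , from = cross i<q j<M in (λ a → to (symm a) ∘ sym) , λ i≢j → symm (from (i≢j ∘ sym))
    ... | inj₂ (i′ , refl , i<M) | inj₁ j<q
      rewrite extended-q+ i′ | [q+i]%q≡i%q t i′ = cross j<q i<M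
    ... | inj₂ (i′ , refl , i<M) | inj₂ (j′ , refl , j<M)
      rewrite extended-q+ i′ | [q+i]%q≡i%q t i′ | extended-q+ j′ | [q+i]%q≡i%q t j′ = turán i<M j<M

    applyUpTo-extended : applyUpTo extended (q + M) ↭ A ++ applyUpTo f M
    applyUpTo-extended = ↭-trans
      (↭-reflexive (≡.trans (cong (λ n → applyUpTo extended (n + M)) (sym ∣A′∣≡q)) (applyUpTo-glue A′ f M)))
      (↭.++⁺ʳ (applyUpTo f M) (↭-sym (proj₂ ordered)))

  private
    -- Maximality is tracked at the order min(N, q) because the remainder may drop below q vertices:
    -- then order N detects that it is complete. Equality at order q yields equality at every order
    -- up to q for the remainder, hence also at its own minimum. The argument `d` fills labellings
    -- beyond their length.
    zykov-unique′ : V → ∀ xs → Acc _<_ (length xs) → cl (suc q) xs ≡ 0 →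
                    cl (length xs ⊓ q) xs ≡ z t (length xs) (length xs ⊓ q) → IsTurán xs
    zykov-unique′ d xs (acc rec) free max with length xs ≤? q
    ... | yes l≤q
      with ys , τ , ys! , l ← cl>0⇒Clique (length xs) xs
             (subst (0 <_) (sym (≡.trans (subst (λ i → cl i xs ≡ z t (length xs) i) (m≤n⇒m⊓n≡m l≤q) max) (≡.trans (z-small t (length xs) l≤q) (nCn≡1 (length xs))))) z<s)
      with refl ← ⊆-length-≡ τ l
      = glue xs (λ _ → d)
      , ↭-reflexive (≡.trans (cong (applyUpTo _) (sym (+-identityʳ (length xs))))
          (≡.trans (applyUpTo-glue xs (λ _ → d) 0) (++-identityʳ xs)))
      , Clique-turán (λ _ → d) ys! l≤q
    ... | no l≰q
      with max-q ← subst (λ i → cl i xs ≡ z t (length xs) i) (m≥n⇒m⊓n≡n (≰⇒≥ l≰q)) max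
      -- Maximality at order q itself supplies a q-clique, so no filling up occurs here.
      with A , B , p , A! , ∣A∣≡q ← split-Clique {q} {xs}
             (subst (0 <_) (sym max-q) (≤-trans
               (≤-reflexive (sym (≡.trans (z-small t q ≤-refl) (nCn≡1 q))))
               (z-monoˡ-≤ t q (<⇒≤ (≰⇒> l≰q)))))
      = unique
      where
      ∣xs∣≡ : length xs ≡ q + length B
      ∣xs∣≡ = ≡.trans (↭.↭-length p) (≡.trans (length-++ A) (cong (_+ length B) ∣A∣≡q))

      xs↭ : xs ↭ B ++ A
      xs↭ = ↭-trans p (↭.++-comm A B)

      free′ : cl (suc q) (B ++ A) ≡ 0
      free′ = ≡.trans (sym (cl-↭ symm (suc q) xs↭)) free

      B-free : cl (suc q) B ≡ 0
      B-free = n≤0⇒n≡0 (≤-trans (cl-mono-⊆ (suc q) (⊆.++⁺ʳ A (⊆-refl {x = B}))) (≤-reflexive free′))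

      -- The three inequalities close a cycle, so all are equalities. The first determines the edges
      -- between `B` and `A`; the second makes `B` maximal.
      ≤₁ : cl q (B ++ A) ≤ W q q (λ i → cl i B)
      ≤₁ = cl-++≤W q 0 q [] A B A! z≤n free′

      ≤₂ : W q q (λ i → cl i B) ≤ W q q (z t (length B))
      ≤₂ = W-mono-≤ q q (zykov {B} B-free)

      ≤₃ : W q q (z t (length B)) ≤ cl q (B ++ A)
      ≤₃ = ≤-trans (W≤z t (length B) q) (≤-reflexive (≡.trans (cong (λ n → z t n q) (sym ∣xs∣≡))
             (≡.trans (sym max-q) (cl-↭ symm q xs↭))))

      B<xs : length B < length xs
      B<xs = <-≤-trans (m<n+m (length B) z<s) (≤-reflexive (sym ∣xs∣≡))

      many : All (λ b → q ≤ suc (length (nbrs b A))) B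
      many = cl-++≡W⇒nbrs q A B A! free′ (≤-antisym ≤₁ (≤-trans ≤₂ ≤₃))

      unique : IsTurán xs
      unique with f , f↭ , turán ← zykov-unique′ d B (rec B<xs) B-free
                    (W-diag-≡ q (zykov {B} B-free) (≤-antisym ≤₂ (≤-trans ≤₃ ≤₁)) (length B ⊓ q) (m⊓n≤n (length B) q))
        = let M = length B
              free″ = ≡.trans (cl-↭ symm (suc q) (↭.++⁺ʳ A f↭)) free′
              many′ = λ {j} j<M → All.lookup many (↭.∈-resp-↭ f↭ (∈-applyUpTo⁺ f {j} {M} j<M))
              f⁺ = extended A! ∣A∣≡q M f turán free″ many′
          in f⁺
           , subst (λ n → applyUpTo f⁺ n ↭ xs) (sym ∣xs∣≡) (↭-trans
               (applyUpTo-extended A! ∣A∣≡q M f turán free″ many′)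
               (↭-trans (↭.++⁺ˡ A f↭) (↭-sym p)))
           , λ i<N j<N → extended-turán A! ∣A∣≡q M f turán free″ many′
               (subst (_ <_) ∣xs∣≡ i<N) (subst (_ <_) ∣xs∣≡ j<N)

  zykov-unique : V → ∀ {xs} → cl (suc q) xs ≡ 0 →
                 cl (length xs ⊓ q) xs ≡ z t (length xs) (length xs ⊓ q) → IsTurán xs
  zykov-unique d {xs} = zykov-unique′ d xs (<-wellFounded _)

  -- With q ≤ `length R` every class has a representative among the first q labels, and `x` misses
  -- only that of its own class; at least t pairwise adjacent neighbours remain.
  IsTurán⇒extends : ∀ {R} → q ≤ length R → IsTurán R → 0 < cl t R × All (λ x → 0 < cl t (nbrs x R)) R
  IsTurán⇒extends {R} q≤R (f , p , turán) = positive , All.tabulate extends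
    where
    A = applyUpTo f q

    A⊆ : A ⊆ applyUpTo f (length R)
    A⊆ = applyUpTo-mono-⊆ f q≤R

    A! : Clique A
    A! = AllPairs.applyUpTo⁺₁ f q λ i<j j<q → proj₂ (turán (<-≤-trans (<-trans i<j j<q) q≤R) (<-≤-trans j<q q≤R))
      (subst₂ _≢_ (sym (<q⇒%≡ (<-trans i<j j<q))) (sym (<q⇒%≡ j<q)) (<⇒≢ i<j))

    Clique⇒0<cl : ∀ {xs} → Clique xs → t ≤ length xs → 0 < cl t xs
    Clique⇒0<cl xs! t≤ = <-≤-trans (k≤n⇒0<nCk t≤) (≤-reflexive (sym (cl-Clique t xs!)))

    positive : 0 < cl t R
    positive = <-≤-trans (Clique⇒0<cl A! (≤-trans (n≤1+n t) (≤-reflexive (sym (length-applyUpTo f q)))))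
      (≤-trans (cl-mono-⊆ t A⊆) (≤-reflexive (cl-↭ symm t p)))

    extends : ∀ {x} → x ∈ R → 0 < cl t (nbrs x R)
    extends {x} x∈R with i , i<R , refl ← ∈-applyUpTo⁻ f (↭.∈-resp-↭ (↭-sym p) x∈R) = begin-strict
      0                                      <⟨ Clique⇒0<cl (Clique-filter (adj? x) A!) t≤ ⟩
      cl t (nbrs x A)                        ≤⟨ cl-mono-⊆ t (filter-mono-⊆ (adj? x) A⊆) ⟩
      cl t (nbrs x (applyUpTo f (length R))) ≡⟨ cl-↭ symm t (filter-↭ (adj? x) p) ⟩
      cl t (nbrs x R)                        ∎
      where
      open ≤-Reasoning
      non-constant : ∀ {y} → y ∈ non x A → y ≡ f (i % q)
      non-constant {y} y∈ with y∈A , ¬adj ← ∈-filter⁻ (¬? ∘ adj? x) {xs = A} y∈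
                          with j , j<q , refl ← ∈-applyUpTo⁻ f y∈A
        = cong f (≡.trans (sym (<q⇒%≡ j<q)) (sym (decidable-stable (i % q ≟ j % q)
            λ i≢j → ¬adj (proj₂ (turán i<R (<-≤-trans j<q q≤R)) i≢j))))
      t≤ : t ≤ length (nbrs x A)
      t≤ = s≤s⁻¹ (≤-trans (≤-reflexive (sym (length-applyUpTo f q))) (length≤1+nbrs x A
        (Unique-constant⇒length≤1
          (Unique.filter⁺ (¬? ∘ adj? x) (AllPairs.map (λ adj eq → irrefl eq adj) A!))
          (All.tabulate non-constant))))

-- Joins with a complete graph

-- J k s f = Σⱼ C(k,j) f(s ∸ j): the number of s-cliques in the join of K k with
-- a graph that has f i cliques of each order i.
J : ℕ → ℕ → (ℕ → ℕ) → ℕ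
J k       zero    f = f zero
J zero    (suc s) f = f (suc s)
J (suc k) (suc s) f = J k s f + J k (suc s) f

J-mono-≤ : ∀ k s {f g} → (∀ i → f i ≤ g i) → J k s f ≤ J k s g
J-mono-≤ k       zero    f≤g = f≤g 0
J-mono-≤ zero    (suc s) f≤g = f≤g (suc s)
J-mono-≤ (suc k) (suc s) f≤g = +-mono-≤ (J-mono-≤ k s f≤g) (J-mono-≤ k (suc s) f≤g)

J-cong : ∀ k s {f g} → (∀ i → f i ≡ g i) → J k s f ≡ J k s g
J-cong k s f≡g = ≤-antisym (J-mono-≤ k s (≤-reflexive ∘ f≡g)) (J-mono-≤ k s (≤-reflexive ∘ sym ∘ f≡g))

f≤J : ∀ k s f → f s ≤ J k s f
f≤J k       zero    f = ≤-refl
f≤J zero    (suc s) f = ≤-refl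
f≤J (suc k) (suc s) f = ≤-trans (f≤J k (suc s) f) (m≤n+m _ (J k s f))

-- The term j = 1: one apex together with an s-clique of the rest.
k*f≤J : ∀ k s f → k * f s ≤ J k (suc s) f
k*f≤J zero    s f = z≤n
k*f≤J (suc k) s f = +-mono-≤ (f≤J k s f) (k*f≤J k s f)

J-≡⇒≡ : ∀ k s {f g} → (∀ i → f i ≤ g i) → J k s f ≡ J k s g → f s ≡ g s
J-≡⇒≡ k       zero    f≤g eq = eq
J-≡⇒≡ zero    (suc s) f≤g eq = eq
J-≡⇒≡ (suc k) (suc s) f≤g eq =
  J-≡⇒≡ k (suc s) f≤g (+-≤-≡⇒≡ʳ (J-mono-≤ k s f≤g) (J-mono-≤ k (suc s) f≤g) eq)

-- The coefficient of `f s` is 1 + k, so a deficit at this order would show in the sum.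
J-suc-≡⇒≡ : ∀ k s {f g} → (∀ i → f i ≤ g i) → J (suc k) (suc s) f ≡ J (suc k) (suc s) g → f s ≡ g s
J-suc-≡⇒≡ k s f≤g eq =
  J-≡⇒≡ k s f≤g (+-≤-≡⇒≡ˡ (J-mono-≤ k s f≤g) (J-mono-≤ k (suc s) f≤g) eq)

module Joins {Adj : Rel V 0ℓ} (adj? : Decidable Adj) where

  open Cliques adj?

  Joined : List V → List V → Set
  Joined U R = Clique U × All (λ u → All (Adj u) R) U

  cl-++≤J : ∀ s U R → cl s (U ++ R) ≤ J (length U) s (λ i → cl i R)
  cl-++≤J zero    U       R = ≤-refl
  cl-++≤J (suc s) []      R = ≤-refl
  cl-++≤J (suc s) (u ∷ U) R =
    +-mono-≤ (≤-trans (cl-nbrs s u (U ++ R)) (cl-++≤J s U R)) (cl-++≤J (suc s) U R)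

  cl-Joined : ∀ s U R → Joined U R → cl s (U ++ R) ≡ J (length U) s (λ i → cl i R)
  cl-Joined zero    U       R _ = refl
  cl-Joined (suc s) []      R _ = refl
  cl-Joined (suc s) (u ∷ U) R (u-U ∷ U! , u-R ∷ U-R) = cong₂ _+_
    (≡.trans (cong (cl s) (filter-all (adj? u) (All.++⁺ u-U u-R))) (cl-Joined s U R (U! , U-R)))
    (cl-Joined (suc s) U R (U! , U-R))

  module _ (symm : Symmetric Adj) (irrefl : Irreflexive _≡_ Adj) (t : ℕ) where

    -- If every vertex of R lies in a (1 + t)-clique of R, then a vertex of U
    -- that misses a vertex x loses a (1 + t)-clique through x.
    cl-≡J⇒Joined : ∀ U R → 0 < cl t R → All (λ x → 0 < cl t (nbrs x R)) R →
                   cl (2 + t) (U ++ R) ≡ J (length U) (2 + t) (λ i → cl i R) → Joined U R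
    cl-≡J⇒Joined []      R _   _  _  = [] , []
    cl-≡J⇒Joined (u ∷ U) R pos ps eq =
      (All.++⁻ˡ U u-all ∷ proj₁ joined) , (All.++⁻ʳ U u-all ∷ proj₂ joined)
      where
      q = suc t
      ≤₁ = ≤-trans (cl-nbrs q u (U ++ R)) (cl-++≤J q U R)
      ≤₂ = cl-++≤J (suc q) U R

      joined : Joined U R
      joined = cl-≡J⇒Joined U R pos ps (+-≤-≡⇒≡ʳ ≤₁ ≤₂ eq)

      nbrs-≡ : cl q (nbrs u (U ++ R)) ≡ cl q (U ++ R)
      nbrs-≡ = ≤-antisym (cl-nbrs q u (U ++ R))
        (≤-trans (cl-++≤J q U R) (≤-reflexive (sym (+-≤-≡⇒≡ˡ ≤₁ ≤₂ eq))))

      extends : ∀ {x} → x ∈ U ++ R → 0 < cl t (nbrs x (U ++ R))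
      extends {x} x∈ with ∈-++⁻ U x∈
      -- By induction `x` is adjacent to all of `R`, so any t-clique of `R` extends it.
      ... | inj₁ x∈U = <-≤-trans pos (cl-mono-⊆ t (subst (_⊆ nbrs x (U ++ R))
              (filter-all (adj? x) (All.lookup (proj₂ joined) x∈U)) (filter-mono-⊆ (adj? x) (⊆.++⁺ˡ U ⊆-refl))))
      ... | inj₂ x∈R = <-≤-trans (All.lookup ps x∈R) (cl-mono-⊆ t (filter-mono-⊆ (adj? x) (⊆.++⁺ˡ U ⊆-refl)))

      u-adj : ∀ {x} → x ∈ U ++ R → Adj u x
      u-adj {x} x∈ = decidable-stable (adj? u x) λ ¬ux →
        let xs , ys , eq′ = ∈-∃++ x∈
            zs = xs ++ ys
            p  = ↭-trans (↭-reflexive eq′) (↭.shift x xs ys)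
        in <⇒≢ (begin-strict
             cl q (nbrs u (U ++ R))            ≡⟨ cl-↭ symm q (filter-↭ (adj? u) p) ⟩
             cl q (nbrs u (x ∷ zs))            ≡⟨ cong (cl q) (filter-reject (adj? u) ¬ux) ⟩
             cl q (nbrs u zs)                  ≤⟨ cl-nbrs q u zs ⟩
             cl q zs                           <⟨ m<n+m (cl q zs) (extends x∈) ⟩
             cl t (nbrs x (U ++ R)) + cl q zs  ≡⟨ cong (_+ cl q zs) (≡.trans (cl-↭ symm t (filter-↭ (adj? x) p))
                                                    (cong (cl t) (filter-reject (adj? x) (irrefl refl)))) ⟩
             cl q (x ∷ zs)                     ≡⟨ cl-↭ symm q p ⟨
             cl q (U ++ R)                     ∎) nbrs-≡
        where open ≤-Reasoning

      u-all : All (Adj u) (U ++ R)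
      u-all = All.tabulate u-adj

-- Disjoint cliques and heavy vertices

-- Chosen so that in both cases of the induction in apex-or-few the lower-order
-- terms are at most error r k * n ^ t.
error : ℕ → ℕ → ℕ
error r zero    = 0
error r (suc k) = error r k + suc k * r + (2 + k) * r * (suc k * r)

module Packings (t : ℕ) {Adj : Rel V 0ℓ} (adj? : Decidable Adj) (symm : Symmetric Adj) where

  open Cliques adj?
  open Zykov t adj? symm

  private
    q r : ℕ
    q = suc t
    r = suc q

  infixr 5 _∷_

  -- Disjointness is encoded by position: the cliques are consecutive blocks of a rearranged list,
  -- and for `allFin n` different positions are different vertices.
  data Tiled : ℕ → List V → Set where
    []  : Tiled 0 []
    _∷_ : ∀ {m Q P} → Clique Q × length Q ≡ r → Tiled m P → Tiled (suc m) (Q ++ P)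

  Packing : ℕ → List V → Set
  Packing m xs = ∃₂ λ P R → Tiled m P × xs ↭ P ++ R

  Tiled-length : ∀ {m P} → Tiled m P → length P ≡ m * r
  Tiled-length []                          = refl
  Tiled-length (_∷_ {Q = Q} (_ , ∣Q∣≡r) T) =
    ≡.trans (length-++ Q) (cong₂ _+_ ∣Q∣≡r (Tiled-length T))

  Packing-++ : ∀ {m Q xs ys} → Clique Q → length Q ≡ r → ys ↭ Q ++ xs → Packing m xs → Packing (suc m) ys
  Packing-++ {Q = Q} Q! ∣Q∣≡r p (P , R , T , p′) = Q ++ P , R , (Q! , ∣Q∣≡r) ∷ T ,
    ↭-trans p (↭-trans (↭.++⁺ˡ Q p′) (↭-reflexive (sym (++-assoc Q P R))))

  -- Greedy removal of r-cliques: if it stops before `m` of them, the removed vertices meet every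
  -- r-clique.
  transversal : ∀ m xs → Packing m xs ⊎ ∃₂ λ S R → xs ↭ S ++ R × length S ≤ m * r × cl r R ≡ 0
  transversal zero    xs = inj₁ ([] , xs , [] , ↭-refl)
  transversal (suc m) xs with cl r xs ≟ 0
  ... | yes free = inj₂ ([] , xs , ↭-refl , z≤n , free)
  ... | no  ¬free with Q , xs′ , p , Q! , ∣Q∣≡r ← split-Clique (n≢0⇒n>0 ¬free)
                  with transversal m xs′
  ... | inj₁ packing = inj₁ (Packing-++ Q! ∣Q∣≡r p packing)
  ... | inj₂ (S , R , p′ , ∣S∣≤ , free) = inj₂ (Q ++ S , R
    , ↭-trans p (↭-trans (↭.++⁺ˡ Q p′) (↭-reflexive (sym (++-assoc Q S R))))
    , ≤-trans (≤-reflexive (length-++ Q)) (+-mono-≤ (≤-reflexive ∣Q∣≡r) ∣S∣≤)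
    , free)

  module _ (n : ℕ) where

    private
      nbrs-avoiding : ∀ {m v ys P R} → length ys ≤ n → Tiled m P → ys ↭ P ++ R →
                      cl q (nbrs v ys) ≤ m * r * n ^ t + cl q (nbrs v R)
      nbrs-avoiding {m} {v} {ys} {P} {R} l≤n T p = begin
        cl q (nbrs v ys)               ≡⟨ cl-↭ symm q split ⟩
        cl q (P⁺ ++ R⁺)                ≤⟨ cl-++≤ t P⁺ R⁺ (≤-trans (≤-reflexive (sym (↭.↭-length split)))
                                            (≤-trans (length-filter (adj? v) ys) l≤n)) ⟩
        length P⁺ * n ^ t + cl q R⁺    ≤⟨ +-monoˡ-≤ (cl q R⁺) (*-monoˡ-≤ (n ^ t)
                                            (≤-trans (length-filter (adj? v) P) (≤-reflexive (Tiled-length T)))) ⟩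
        m * r * n ^ t + cl q R⁺        ∎
        where
        open ≤-Reasoning
        P⁺ = nbrs v P
        R⁺ = nbrs v R
        split : nbrs v ys ↭ P⁺ ++ R⁺
        split = ↭-trans (filter-↭ (adj? v) p) (↭-reflexive (filter-++ (adj? v) P R))

    -- At most m r nᵗ of the cliques through v meet a given packing of size m, so
    -- a vertex in more cliques than that enlarges the packing.
    heavy-vertex : ∀ m v ys → length ys ≤ n → m * r * n ^ t < cl q (nbrs v ys) →
                   Packing m ys → Packing (suc m) (v ∷ ys)
    heavy-vertex m v ys l≤n heavy (P , R , T , p)
      with Q , τ , Q! , ∣Q∣≡q ← cl>0⇒Clique q (nbrs v R) (+-cancelˡ-< (m * r * n ^ t) 0 _
             (<-≤-trans (≤-<-trans (≤-reflexive (+-identityʳ _)) heavy) (nbrs-avoiding l≤n T p)))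
      with R′ , p′ ← ⊆⇒↭ (⊆-trans τ (⊆.filter-⊆ (adj? v) R))
      = Packing-++ {Q = v ∷ Q} (⊆.All-resp-⊆ τ (All.all-filter (adj? v) R) ∷ Q!) (cong suc ∣Q∣≡q)
          (prep v (↭-trans p (↭-trans (↭.++⁺ˡ P p′) (↭-trans (↭-reflexive (sym (++-assoc P Q R′)))
            (↭-trans (↭.++⁺ʳ R′ (↭.++-comm P Q)) (↭-reflexive (++-assoc Q P R′)))))))
          (P , R′ , T , ↭-refl)

    -- Vertices of `S` are removed one at a time, each charged with the cliques it still lies in. A
    -- vertex heavy in what remains stays heavy when the earlier ones are put back.
    light-or-heavy : ∀ d S R → cl r (S ++ R) ≤ length S * d + cl r R ⊎
                     ∃₂ λ v ys → S ++ R ↭ v ∷ ys × d < cl q (nbrs v ys)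
    light-or-heavy d []      R = inj₁ ≤-refl
    light-or-heavy d (x ∷ S) R with d <? cl q (nbrs x (S ++ R))
    ... | yes heavy = inj₂ (x , S ++ R , ↭-refl , heavy)
    ... | no ¬heavy with light-or-heavy d S R
    ... | inj₁ light = inj₁ (≤-trans (+-mono-≤ (≮⇒≥ ¬heavy) light) (≤-reflexive (sym (+-assoc d _ _))))
    ... | inj₂ (v , ys , p , heavy) = inj₂ (v , x ∷ ys , ↭-trans (prep x p) (swap x v ↭-refl)
      , <-≤-trans heavy (cl-mono-⊆ q (filter-mono-⊆ (adj? v) (x ∷ʳ ⊆-refl))))

    private
      Z = z t n q

    -- Each heavy vertex found is removed, which costs at most `Z` plus a lower-order term and
    -- lowers the forbidden packing size by one. If no heavy vertex turns up while k is positive,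
    -- only O(n ^ t) cliques are left. The second alternative means (k - 1) Z plus an error, written
    -- without subtraction. The bound `n` stays fixed so that `Z` and `n ^ t` do not change with the
    -- list.
    apex-or-few : ∀ k xs → length xs ≤ n → ¬ Packing (suc k) xs →
      (∃₂ λ U R → xs ↭ U ++ R × length U ≡ k × cl r R ≡ 0) ⊎ cl r xs + Z ≤ k * Z + error r k * n ^ t
    apex-or-few zero xs _ ¬packing with cl r xs ≟ 0
    ... | yes free = inj₁ ([] , xs , ↭-refl , refl , free)
    ... | no ¬free with Q , R , p , Q! , ∣Q∣≡r ← split-Clique (n≢0⇒n>0 ¬free)
      = contradiction (Packing-++ Q! ∣Q∣≡r p ([] , R , [] , ↭-refl)) ¬packing
    apex-or-few (suc k) xs l≤n ¬packing with transversal (2 + k) xs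
    ... | inj₁ packing = contradiction packing ¬packing
    ... | inj₂ (S , R , p , ∣S∣≤ , free) with light-or-heavy (suc k * r * n ^ t) S R
    ... | inj₁ light = inj₂ (begin
      cl r xs + Z
        ≡⟨ cong (_+ Z) (cl-↭ symm r p) ⟩
      cl r (S ++ R) + Z
        ≤⟨ +-monoˡ-≤ Z light ⟩
      length S * d + cl r R + Z
        ≡⟨ cong (λ c → length S * d + c + Z) free ⟩
      length S * d + 0 + Z
        ≡⟨ cong (_+ Z) (+-identityʳ _) ⟩
      length S * d + Z
        ≤⟨ +-monoˡ-≤ Z (*-monoˡ-≤ d ∣S∣≤) ⟩
      (2 + k) * r * d + Z
        ≤⟨ m≤m+n _ (k * Z + (error r k + suc k * r) * n ^ t) ⟩
      (2 + k) * r * d + Z + (k * Z + (error r k + suc k * r) * n ^ t)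
        ≡⟨ solve 6 (λ a b N K E Zs → a :* (b :* N) :+ Zs :+ (K :* Zs :+ (E :+ b) :* N)
                      := Zs :+ K :* Zs :+ (E :+ b :+ a :* b) :* N)
             refl ((2 + k) * r) (suc k * r) (n ^ t) k (error r k) Z ⟩
      suc k * Z + error r (suc k) * n ^ t ∎)
      where
      open ≤-Reasoning
      open +-*-Solver
      d = suc k * r * n ^ t
    ... | inj₂ (v , ys , p′ , heavy) = from-ys
      where
      p″ = ↭-trans p p′
      ys≤n : length ys ≤ n
      ys≤n = ≤-trans (n≤1+n _) (≤-trans (≤-reflexive (sym (↭.↭-length p″))) l≤n)
      ¬packing-ys : ¬ Packing (suc k) ys
      ¬packing-ys packing = let P , R , T , p‴ = heavy-vertex (suc k) v ys ys≤n heavy packing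
                            in ¬packing (P , R , T , ↭-trans p″ p‴)
      -- The cliques through `v` are q-cliques of `ys`. Outside a bounded set `ys` has no r-clique,
      -- so Zykov's theorem at order q = r - 1 applies.
      degree≤ : cl q (nbrs v ys) ≤ suc k * r * n ^ t + Z
      degree≤ with transversal (suc k) ys
      ... | inj₁ packing = contradiction packing ¬packing-ys
      ... | inj₂ (S′ , R′ , ys↭ , ∣S′∣≤ , free′) = begin
        cl q (nbrs v ys)                         ≤⟨ cl-nbrs q v ys ⟩
        cl q ys                                  ≡⟨ cl-↭ symm q ys↭ ⟩
        cl q (S′ ++ R′)                          ≤⟨ cl-++≤ t S′ R′ S′++R′≤n ⟩
        length S′ * n ^ t + cl q R′              ≤⟨ +-mono-≤ (*-monoˡ-≤ (n ^ t) ∣S′∣≤) (≤-trans (zykov {R′} free′ q)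
                                                      (z-monoˡ-≤ t q R′≤n)) ⟩
        suc k * r * n ^ t + Z                    ∎
        where
        open ≤-Reasoning
        S′++R′≤n = ≤-trans (≤-reflexive (sym (↭.↭-length ys↭))) ys≤n
        R′≤n = ≤-trans (≤-trans (m≤n+m _ (length S′)) (≤-reflexive (sym (length-++ S′)))) S′++R′≤n
      from-ys : (∃₂ λ U R → xs ↭ U ++ R × length U ≡ suc k × cl r R ≡ 0) ⊎
                cl r xs + Z ≤ suc k * Z + error r (suc k) * n ^ t
      from-ys with apex-or-few k ys ys≤n ¬packing-ys
      ... | inj₁ (U , R′ , ys↭ , ∣U∣≡k , free′) =
        inj₁ (v ∷ U , R′ , ↭-trans p″ (prep v ys↭) , cong suc ∣U∣≡k , free′)
      ... | inj₂ few = inj₂ (begin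
        cl r xs + Z
          ≡⟨ cong (_+ Z) (cl-↭ symm r p″) ⟩
        cl q (nbrs v ys) + cl r ys + Z
          ≡⟨ +-assoc (cl q (nbrs v ys)) _ Z ⟩
        cl q (nbrs v ys) + (cl r ys + Z)
          ≤⟨ +-mono-≤ degree≤ few ⟩
        suc k * r * n ^ t + Z + (k * Z + error r k * n ^ t)
          ≤⟨ m≤m+n _ ((2 + k) * r * (suc k * r) * n ^ t) ⟩
        suc k * r * n ^ t + Z + (k * Z + error r k * n ^ t) + (2 + k) * r * (suc k * r) * n ^ t
          ≡⟨ solve 6 (λ a b N K E Zs → b :* N :+ Zs :+ (K :* Zs :+ E :* N) :+ a :* b :* N
                        := Zs :+ K :* Zs :+ (E :+ b :+ a :* b) :* N)
               refl ((2 + k) * r) (suc k * r) (n ^ t) k (error r k) Z ⟩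
        suc k * Z + error r (suc k) * n ^ t ∎)
        where
        open ≤-Reasoning
        open +-*-Solver

-- Clique counts over vertex subsets, and invariance under isomorphism

filter-map : ∀ {A B : Set} {P : U.Pred B 0ℓ} (P? : U.Decidable P) (f : A → B) xs →
             filter P? (map f xs) ≡ map f (filter (P? ∘ f) xs)
filter-map P? f []       = refl
filter-map P? f (x ∷ xs) with does (P? (f x))
... | true  = cong (f x ∷_) (filter-map P? f xs)
... | false = filter-map P? f xs

filter-filter : ∀ {A : Set} {P Q : U.Pred A 0ℓ} (P? : U.Decidable P) (Q? : U.Decidable Q) xs →
                filter P? (filter Q? xs) ≡ filter (λ x → Q? x ×-dec P? x) xs
filter-filter P? Q? []       = refl
filter-filter P? Q? (x ∷ xs) with does (Q? x)
... | false = filter-filter P? Q? xs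
... | true with does (P? x)
... | true  = cong (x ∷_) (filter-filter P? Q? xs)
... | false = filter-filter P? Q? xs

module _ {n : ℕ} (Adj : Rel (Fin n) 0ℓ) (R : U.Pred (Fin n) 0ℓ) where

  CliqueIn : ℕ → Subset n → Set
  CliqueIn s p = ∣ p ∣ ≡ s × (∀ i → i Subset.∈ p → R i) ×
                 (∀ i j → i Subset.∈ p → j Subset.∈ p → i ≢ j → Adj i j)

-- Sets that contain vertex 0 become cliques among its neighbours, which is why a vertex predicate
-- `R` is carried along. Fixing the first bit also changes the decision procedure, so `P?` is
-- arbitrary and only its extension is prescribed.
count-cliques : ∀ n {Adj : Rel (Fin n) 0ℓ} (adj? : Decidable Adj) → Symmetric Adj →
  {R : U.Pred (Fin n) 0ℓ} (R? : U.Decidable R) (s : ℕ) {P : U.Pred (Subset n) 0ℓ} (P? : U.Decidable P) →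
  (∀ p → P p → CliqueIn Adj R s p) → (∀ p → CliqueIn Adj R s p → P p) →
  length (filter P? (subsets n)) ≡ Cliques.cl adj? s (filter R? (allFin n))
count-cliques zero adj? symm R? zero P? to from
  rewrite filter-accept P? {xs = []} (from Vec.[] (refl , (λ _ ()) , λ _ _ ())) = refl
count-cliques zero adj? symm R? (suc s) P? to from
  rewrite filter-reject P? {xs = []} (λ p → case proj₁ (to Vec.[] p) of λ ()) = refl
count-cliques (suc n) {Adj} adj? symm {R} R? s {P} P? to from = begin
  length (filter P? (map (true Vec.∷_) S ++ map (false Vec.∷_) S))
    ≡⟨ cong length (filter-++ P? (map (true Vec.∷_) S) _) ⟩
  length (filter P? (map (true Vec.∷_) S) ++ filter P? (map (false Vec.∷_) S))
    ≡⟨ length-++ (filter P? (map (true Vec.∷_) S)) ⟩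
  length (filter P? (map (true Vec.∷_) S)) + length (filter P? (map (false Vec.∷_) S))
    ≡⟨ cong₂ _+_ (length-filter-map (true Vec.∷_)) (length-filter-map (false Vec.∷_)) ⟩
  length (filter (P? ∘ (true Vec.∷_)) S) + length (filter (P? ∘ (false Vec.∷_)) S)
    ≡⟨ cong (length (filter (P? ∘ (true Vec.∷_)) S) +_) without-zero ⟩
  length (filter (P? ∘ (true Vec.∷_)) S) + G.cl s X
    ≡⟨ with-zero s to from ⟩
  G.cl s (filter R? (zero ∷ map suc (allFin n)))
    ≡⟨ cong (λ xs → G.cl s (filter R? (zero ∷ xs))) (map-tabulate id suc) ⟩
  G.cl s (filter R? (allFin (suc n))) ∎
  where
  open ≡-Reasoning
  module G = Cliques adj?
  S = subsets n
  Adj′ : Rel (Fin n) 0ℓ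
  Adj′ i j = Adj (suc i) (suc j)
  adj′? : Decidable Adj′
  adj′? i j = adj? (suc i) (suc j)
  X = map suc (filter (R? ∘ suc) (allFin n))

  length-filter-map : ∀ f → length (filter P? (map f S)) ≡ length (filter (P? ∘ f) S)
  length-filter-map f = ≡.trans (cong length (filter-map P? f S)) (length-map f (filter (P? ∘ f) S))

  without-zero : length (filter (P? ∘ (false Vec.∷_)) S) ≡ G.cl s X
  without-zero = ≡.trans
    (count-cliques n adj′? symm (R? ∘ suc) s (P? ∘ (false Vec.∷_))
      (λ p Pp → let l , r , a = to (false Vec.∷ p) Pp in
        l , (λ i i∈ → r (suc i) (there i∈)) ,
        λ i j i∈ j∈ i≢j → a (suc i) (suc j) (there i∈) (there j∈) (i≢j ∘ Fin.suc-injective))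
      (λ p (l , r , a) → from (false Vec.∷ p) (l , (λ where (suc i) (there i∈) → r i i∈) ,
        λ where (suc i) (suc j) (there i∈) (there j∈) i≢j → a i j i∈ j∈ (i≢j ∘ cong suc))))
    (sym (cl-map adj′? adj? suc (λ _ _ → id) (λ _ _ → id) s _))

  none : (∀ p → ¬ P (true Vec.∷ p)) → length (filter (P? ∘ (true Vec.∷_)) S) ≡ 0
  none ¬P = cong length (filter-none (P? ∘ (true Vec.∷_)) (All.universal ¬P S))

  with-zero : ∀ s → (∀ p → P p → CliqueIn Adj R s p) → (∀ p → CliqueIn Adj R s p → P p) →
              length (filter (P? ∘ (true Vec.∷_)) S) + G.cl s X ≡ G.cl s (filter R? (zero ∷ map suc (allFin n)))
  with-zero zero to from = cong (_+ 1) (none λ p Pp → case proj₁ (to _ Pp) of λ ())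
  with-zero (suc s) to from with R? zero
  ... | no ¬R₀ = cong₂ _+_ (none λ p Pp → ¬R₀ (proj₁ (proj₂ (to _ Pp)) zero here))
                           (cong (G.cl (suc s)) (sym (filter-map R? suc (allFin n))))
  ... | yes R₀ = cong₂ _+_ (begin
      length (filter (P? ∘ (true Vec.∷_)) S)
        ≡⟨ count-cliques n adj′? symm (λ i → R? (suc i) ×-dec adj? zero (suc i)) s (P? ∘ (true Vec.∷_))
             (λ p Pp → let l , r , a = to (true Vec.∷ p) Pp in
               suc-injective l ,
               (λ i i∈ → r (suc i) (there i∈) , a zero (suc i) here (there i∈) λ ()) ,
               λ i j i∈ j∈ i≢j → a (suc i) (suc j) (there i∈) (there j∈) (i≢j ∘ Fin.suc-injective))
             (λ p (l , r , a) → from (true Vec.∷ p) (cong suc l ,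
               (λ { zero here → R₀ ; (suc i) (there i∈) → proj₁ (r i i∈) }) ,
               λ { zero    zero    _          _          i≢j → contradiction refl i≢j
                 ; zero    (suc j) _          (there j∈) _   → proj₂ (r j j∈)
                 ; (suc i) zero    (there i∈) _          _   → symm (proj₂ (r i i∈))
                 ; (suc i) (suc j) (there i∈) (there j∈) i≢j → a i j i∈ j∈ (i≢j ∘ cong suc) })) ⟩
      Cliques.cl adj′? s (filter (λ i → R? (suc i) ×-dec adj? zero (suc i)) (allFin n))
        ≡⟨ cl-map adj′? adj? suc (λ _ _ → id) (λ _ _ → id) s _ ⟨
      G.cl s (map suc (filter (λ i → R? (suc i) ×-dec adj? zero (suc i)) (allFin n)))
        ≡⟨ cong (G.cl s ∘ map suc) (filter-filter (adj? zero ∘ suc) (R? ∘ suc) (allFin n)) ⟨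
      G.cl s (map suc (filter (adj? zero ∘ suc) (filter (R? ∘ suc) (allFin n))))
        ≡⟨ cong (G.cl s) (filter-map (adj? zero) suc (filter (R? ∘ suc) (allFin n))) ⟨
      G.cl s (G.nbrs zero X)
        ≡⟨ cong (G.cl s ∘ G.nbrs zero) (filter-map R? suc (allFin n)) ⟨
      G.cl s (G.nbrs zero (filter R? (map suc (allFin n)))) ∎)
    (cong (G.cl (suc s)) (sym (filter-map R? suc (allFin n))))

#K≡cl : ∀ {n} (G : Graph n) s → #K s G ≡ Cliques.cl (adj? G) s (allFin n)
#K≡cl {n} G s = ≡.trans
  (count-cliques n (adj? G) (symm G) {R = U.U} (λ _ → yes tt) s (isClique? G s)
    (λ p (l , a) → l , (λ _ _ → tt) , a) (λ p (l , _ , a) → l , a))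
  (cong (Cliques.cl (adj? G) s) (filter-all (λ _ → yes tt) (All.universal (λ _ → tt) (allFin n))))

module _ {m n : ℕ} {G : Graph m} {H : Graph n} (iso : G ≅ H) where

  private
    f = proj₁ iso
    f-adj = proj₂ iso

    ↔-injective : ∀ {x y} → Inverse.to f x ≡ Inverse.to f y → x ≡ y
    ↔-injective = Injection.injective (↔⇒↣ f)

  ⊑-resp-≅ : ∀ {l} {F : Graph l} → F ⊑ G → F ⊑ H
  ⊑-resp-≅ (e , e-injective , e-adj) = Inverse.to f ∘ e
    , (λ eq → e-injective (↔-injective eq))
    , λ x y a → Equivalence.to (f-adj (e x) (e y)) (e-adj x y a)

  #K-resp-≅ : ∀ s → #K s G ≡ #K s H
  #K-resp-≅ s = begin-equality
    #K s G                              ≡⟨ #K≡cl G s ⟩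
    G.cl s (allFin m)                   ≡⟨ cl-map (adj? G) (adj? H) (Inverse.to f) (λ x y → Equivalence.to (f-adj x y))
                                             (λ x y → Equivalence.from (f-adj x y)) s (allFin m) ⟨
    H.cl s (map (Inverse.to f) (allFin m)) ≡⟨ H.cl-↭ (symm H) s f↭ ⟩
    H.cl s (allFin n)                   ≡⟨ #K≡cl H s ⟨
    #K s H                              ∎
    where
    open ≤-Reasoning
    module G = Cliques (adj? G)
    module H = Cliques (adj? H)
    surplus : ∀ {zs} → allFin n ↭ map (Inverse.to f) (allFin m) ++ zs → m + length zs ≤ m + 0
    surplus {zs} p = begin
      m + length zs                                            ≡⟨ cong (_+ length zs) (≡.trans (length-map _ (allFin m)) (length-tabulate id)) ⟨
      length (map (Inverse.to f) (allFin m)) + length zs       ≡⟨ length-++ (map (Inverse.to f) (allFin m)) ⟨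
      length (map (Inverse.to f) (allFin m) ++ zs)             ≡⟨ ↭.↭-length p ⟨
      length (allFin n)                                        ≡⟨ length-tabulate id ⟩
      n                                                        ≤⟨ Fin.injective⇒≤ (Injection.injective (↔⇒↣ (↔-sym f))) ⟩
      m                                                        ≡⟨ +-identityʳ m ⟨
      m + 0                                                    ∎
    f↭ : map (Inverse.to f) (allFin m) ↭ allFin n
    f↭ with zs , p ← Unique-⊆⇒↭ {ys = allFin n} (Unique.map⁺ ↔-injective (Unique.allFin⁺ m))
                       (All.tabulate λ _ → ∈-allFin _)
       with zs | p | n≤0⇒n≡0 {length zs} (+-cancelˡ-≤ m _ 0 (surplus p))
    ... | [] | p′ | _ = ↭-trans (↭-reflexive (sym (++-identityʳ _))) (↭-sym p′)

-- From packings of cliques to copies of a disjoint union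

Unique-++⇒≢ : ∀ {x y : V} xs {ys} → Unique (xs ++ ys) → x ∈ xs → y ∈ ys → x ≢ y
Unique-++⇒≢ (x ∷ xs) (px ∷ _)  (here refl) y∈ = All.lookup (All.++⁻ʳ xs px) y∈
Unique-++⇒≢ (x ∷ xs) (_ ∷ ps)  (there x∈)  y∈ = Unique-++⇒≢ xs ps x∈ y∈

Unique-++⁻ʳ : ∀ (xs : List V) {ys} → Unique (xs ++ ys) → Unique ys
Unique-++⁻ʳ []       ps       = ps
Unique-++⁻ʳ (x ∷ xs) (_ ∷ ps) = Unique-++⁻ʳ xs ps

AllPairs-lookup : ∀ {R : Rel V 0ℓ} {xs} → AllPairs R xs → ∀ {i j} → i Fin.< j → R (lookup xs i) (lookup xs j)
AllPairs-lookup {xs = _ ∷ xs} (px ∷ _) {zero}  {suc j} _         = All.lookup px (∈-lookup j)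
AllPairs-lookup               (_ ∷ ps) {suc i} {suc j} (s≤s i<j) = AllPairs-lookup ps i<j

Unique-resp-↭ : ∀ {n} {xs ys : List (Fin n)} → xs ↭ ys → Unique xs → Unique ys
Unique-resp-↭ = Cliques.Clique-↭ (λ i j → ¬? (i Fin.≟ j)) (_∘ sym)

cast-injective : ∀ {m n} (eq : m ≡ n) {i j : Fin m} → cast eq i ≡ cast eq j → i ≡ j
cast-injective eq {i} {j} e = Fin.toℕ-injective
  (≡.trans (sym (Fin.toℕ-cast eq i)) (≡.trans (cong toℕ e) (Fin.toℕ-cast eq j)))

tabulate-+ : ∀ {A : Set} m {n} (f : Fin (m + n) → A) → tabulate f ≡ tabulate (f ∘ (_↑ˡ n)) ++ tabulate (f ∘ (m ↑ʳ_))
tabulate-+ zero    f = refl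
tabulate-+ (suc m) f = cong (f zero ∷_) (tabulate-+ m (f ∘ suc))

tabulate-toℕ : ∀ {A : Set} n (f : ℕ → A) → tabulate {n = n} (f ∘ toℕ) ≡ applyUpTo f n
tabulate-toℕ zero    f = refl
tabulate-toℕ (suc n) f = cong (f 0 ∷_) (tabulate-toℕ n (f ∘ suc))

Unique-tabulate⇒injective : ∀ {n} (f : Fin n → V) → Unique (tabulate f) → ∀ {i j} → f i ≡ f j → i ≡ j
Unique-tabulate⇒injective {n = suc n} f _         {zero}  {zero}  _  = refl
Unique-tabulate⇒injective {n = suc n} f (px ∷ _)  {zero}  {suc j} eq = contradiction eq (All.tabulate⁻ px j)
Unique-tabulate⇒injective {n = suc n} f (px ∷ _)  {suc i} {zero}  eq = contradiction (sym eq) (All.tabulate⁻ px i)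
Unique-tabulate⇒injective {n = suc n} f (_ ∷ ps)  {suc i} {suc j} eq = cong suc (Unique-tabulate⇒injective (f ∘ suc) ps eq)

module _ {n : ℕ} (G : Graph n) where

  open Cliques (adj? G)

  Clique-lookup : ∀ {xs} → Clique xs → ∀ {i j} → i ≢ j → Adj G (lookup xs i) (lookup xs j)
  Clique-lookup xs! {i} {j} i≢j with Fin.<-cmp i j
  ... | tri< i<j _ _ = AllPairs-lookup xs! i<j
  ... | tri≈ _ i≡j _ = contradiction i≡j i≢j
  ... | tri> _ _ j<i = symm G (AllPairs-lookup xs! j<i)

  Clique-lookup⁻ : ∀ {xs} → Clique xs → ∀ {i j} → lookup xs i ≡ lookup xs j → i ≡ j
  Clique-lookup⁻ xs! {i} {j} eq with i Fin.≟ j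
  ... | yes i≡j = i≡j
  ... | no  i≢j = contradiction (Clique-lookup xs! i≢j) (irrefl G eq)

  module _ (t : ℕ) where

    open Packings t (adj? G) (symm G)

    private
      r = 2 + t

    tile : ∀ {m P} → Tiled m P → Fin m → Fin r → Fin n
    tile (_∷_ {Q = Q} (_ , ∣Q∣≡r) T) zero    j = lookup Q (cast (sym ∣Q∣≡r) j)
    tile (_ ∷ T)                     (suc i) j = tile T i j

    tile-∈ : ∀ {m P} (T : Tiled m P) i j → tile T i j ∈ P
    tile-∈ (_∷_ {Q = Q} _ T) zero    j = ∈-++⁺ˡ (∈-lookup {xs = Q} _)
    tile-∈ (_∷_ {Q = Q} _ T) (suc i) j = ∈-++⁺ʳ Q (tile-∈ T i j)

    tile-adj : ∀ {m P} (T : Tiled m P) i {j j′} → j ≢ j′ → Adj G (tile T i j) (tile T i j′)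
    tile-adj ((Q! , ∣Q∣≡r) ∷ T) zero    j≢j′ = Clique-lookup Q! (j≢j′ ∘ cast-injective (sym ∣Q∣≡r))
    tile-adj (_ ∷ T)            (suc i) j≢j′ = tile-adj T i j≢j′

    tile-injective : ∀ {m P} (T : Tiled m P) → Unique P → ∀ i i′ {j j′} → tile T i j ≡ tile T i′ j′ → i ≡ i′ × j ≡ j′
    tile-injective ((Q! , ∣Q∣≡r) ∷ T) P! zero zero eq = refl , cast-injective (sym ∣Q∣≡r) (Clique-lookup⁻ Q! eq)
    tile-injective (_∷_ {Q = Q} _ T) P! zero (suc i′) eq = contradiction eq (Unique-++⇒≢ Q P! (∈-lookup _) (tile-∈ T i′ _))
    tile-injective (_∷_ {Q = Q} _ T) P! (suc i) zero eq = contradiction (sym eq) (Unique-++⇒≢ Q P! (∈-lookup _) (tile-∈ T i _))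
    tile-injective (_∷_ {Q = Q} _ T) P! (suc i) (suc i′) eq =
      let i≡ , j≡ = tile-injective T (Unique-++⁻ʳ Q P!) i i′ eq in cong suc i≡ , j≡

    Packing⇒⊑ : ∀ m → Packing m (allFin n) → (m · K r) ⊑ G
    Packing⇒⊑ m (P , R , T , p) = (λ x → tile T (proj₁ (remQuot {m} r x)) (proj₂ (remQuot {m} r x)))
      , (λ {x} {y} eq → let i≡ , j≡ = tile-injective T P! _ _ eq in
          ≡.trans (sym (Fin.combine-remQuot {m} r x)) (≡.trans (cong₂ combine i≡ j≡) (Fin.combine-remQuot {m} r y)))
      , λ x y (i≡ , j≢) → subst (λ i → Adj G (tile T (proj₁ (remQuot {m} r x)) _) (tile T i _)) i≡ (tile-adj T _ j≢)
      where
      P! : Unique P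
      P! = Unique-++⁻ʳ R (Unique-resp-↭ (↭-trans p (↭.++-comm P R)) (Unique.allFin⁺ n))

-- The extremal graph

module _ {n s l : ℕ} {F : Graph l} where

  open IsEx

  IsEx-unique : ∀ {e e′} → IsEx n s F e → IsEx n s F e′ → e ≡ e′
  IsEx-unique ex ex′ = ≤-antisym (below ex ex′) (below ex′ ex)
    where
    below : ∀ {e e′} → IsEx n s F e → IsEx n s F e′ → e ≤ e′
    below ex ex′ = let G , free , #K≡e = attained ex in subst (_≤ _) #K≡e (maximal ex′ G free)

  -- The candidate has order k + (n ∸ k), which equals `n` only propositionally; the equation
  -- bridges the two graph types.
  maximum⇒IsEx : ∀ {m} → m ≡ n → (H : Graph m) → H IsFreeOf F →
                 (∀ (G : Graph n) → G IsFreeOf F → #K s G ≤ #K s H) → IsEx n s F (#K s H)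
  maximum⇒IsEx refl H free max = record { attained = H , free , refl ; maximal = max }

module _ (t k N : ℕ) where

  private
    q r : ℕ
    q = suc t
    r = suc q

  extremalGraph : Graph (k + N)
  extremalGraph = K k +ᴳ turán q N

  private
    H = extremalGraph
    module H = Cliques (adj? H)

  #K-extremalGraph : ∀ s → #K s H ≡ J k s (z t N)
  #K-extremalGraph s = begin
    #K s H                                ≡⟨ #K≡cl H s ⟩
    H.cl s (allFin (k + N))               ≡⟨ cong (H.cl s) (tabulate-+ k id) ⟩
    H.cl s (A ++ B)                       ≡⟨ Joins.cl-Joined (adj? H) s A B (A! , A-B) ⟩
    J (length A) s (λ i → H.cl i B)       ≡⟨ cong (λ m → J m s (λ i → H.cl i B)) (length-tabulate {n = k} (_↑ˡ N)) ⟩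
    J k s (λ i → H.cl i B)                ≡⟨ J-cong k s cl-B ⟩
    J k s (z t N)                         ∎
    where
    open ≡-Reasoning
    A = tabulate (_↑ˡ N)
    B = tabulate (k ↑ʳ_)
    A! : H.Clique A
    A! = AllPairs.tabulate⁺ λ {i} {j} i≢j →
      subst₂ (JoinAdj (K k) (turán q N)) (sym (Fin.splitAt-↑ˡ k i N)) (sym (Fin.splitAt-↑ˡ k j N)) i≢j
    A-B : All (λ a → All (Adj H a) B) A
    A-B = All.tabulate⁺ λ i → All.tabulate⁺ λ j →
      subst₂ (JoinAdj (K k) (turán q N)) (sym (Fin.splitAt-↑ˡ k i N)) (sym (Fin.splitAt-↑ʳ k N j)) tt
    cl-B : ∀ i → H.cl i B ≡ z t N i
    cl-B i = begin
      H.cl i B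
        ≡⟨ cong (H.cl i) (map-tabulate id (k ↑ʳ_)) ⟨
      H.cl i (map (k ↑ʳ_) (allFin N))
        ≡⟨ cl-map (adj? (turán q N)) (adj? H) (k ↑ʳ_)
             (λ x y → subst₂ (JoinAdj (K k) (turán q N)) (sym (Fin.splitAt-↑ʳ k N x)) (sym (Fin.splitAt-↑ʳ k N y)))
             (λ x y → subst₂ (JoinAdj (K k) (turán q N)) (Fin.splitAt-↑ʳ k N x) (Fin.splitAt-↑ʳ k N y)) i (allFin N) ⟩
      Cliques.cl (adj? (turán q N)) i (allFin N)
        ≡⟨ cl-map (adj? (turán q N)) (turánAdj? t) toℕ (λ _ _ → id) (λ _ _ → id) i (allFin N) ⟨
      Cliques.cl (turánAdj? t) i (map toℕ (allFin N))
        ≡⟨ cong (Cliques.cl (turánAdj? t) i) (≡.trans (map-tabulate id toℕ) (tabulate-toℕ N id)) ⟩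
      z t N i ∎

  -- Each copy of K r uses one of the k apices, since the Turán part has only
  -- r ∸ 1 classes.
  extremalGraph-free : ∀ {m} → k < m → H IsFreeOf (m · K r)
  extremalGraph-free {m} k<m (f , f-injective , f-adj) = copies-clash
    where
    vertex : Fin m → Fin r → Fin (k + N)
    vertex c j = f (combine c j)

    vertex-adj : ∀ c {i j} → i ≢ j → JoinAdj (K k) (turán q N) (splitAt k (vertex c i)) (splitAt k (vertex c j))
    vertex-adj c {i} {j} i≢j = f-adj (combine c i) (combine c j)
      (subst₂ (λ u v → proj₁ u ≡ proj₁ v × proj₂ u ≢ proj₂ v)
        (sym (Fin.remQuot-combine c i)) (sym (Fin.remQuot-combine c j)) (refl , i≢j))

    apex? : ∀ (v : Fin k ⊎ Fin N) → Dec (∃ λ x → v ≡ inj₁ x)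
    apex? (inj₁ x) = yes (x , refl)
    apex? (inj₂ y) = no λ ()

    turán-vertex : ∀ (v : Fin k ⊎ Fin N) → ¬ (∃ λ x → v ≡ inj₁ x) → ∃ λ y → v ≡ inj₂ y
    turán-vertex (inj₁ x) ¬apex = contradiction (x , refl) ¬apex
    turán-vertex (inj₂ y) _     = y , refl

    apex : ∀ c → ∃₂ λ j x → splitAt k (vertex c j) ≡ inj₁ x
    apex c with Fin.any? (λ j → apex? (splitAt k (vertex c j)))
    ... | yes found = found
    ... | no ¬found = contradiction (Fin.fromℕ<-injective _ _ _ _ same-class)
        (subst₂ (JoinAdj (K k) (turán q N)) (proj₂ (part i)) (proj₂ (part j)) (vertex-adj c (Fin.<⇒≢ i<j)))
      where
      part : ∀ j → ∃ λ y → splitAt k (vertex c j) ≡ inj₂ y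
      part j = turán-vertex _ λ found → ¬found (j , found)
      clash = Fin.pigeonhole (n<1+n q) λ j → fromℕ< (m%n<n (toℕ (proj₁ (part j))) q)
      i = proj₁ clash
      j = proj₁ (proj₂ clash)
      i<j = proj₁ (proj₂ (proj₂ clash))
      same-class = proj₂ (proj₂ (proj₂ clash))

    copies-clash : ⊥
    copies-clash with c , c′ , c<c′ , eq ← Fin.pigeonhole k<m (λ c → proj₁ (proj₂ (apex c))) =
      Fin.<⇒≢ c<c′ (cong proj₁ (≡.trans (sym (Fin.remQuot-combine c j)) (≡.trans
        (cong (remQuot {m} r) (f-injective same-vertex)) (Fin.remQuot-combine c′ j′))))
      where
      j = proj₁ (apex c)
      j′ = proj₁ (apex c′)
      same-vertex : vertex c j ≡ vertex c′ j′
      same-vertex = ≡.trans (sym (Fin.join-splitAt k N _)) (≡.trans (cong (join k N)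
        (≡.trans (proj₂ (proj₂ (apex c))) (≡.trans (cong inj₁ eq) (sym (proj₂ (proj₂ (apex c′)))))))
        (Fin.join-splitAt k N _))

module _ (t : ℕ) {n : ℕ} (G : Graph n) where

  open Cliques (adj? G)
  open Joins (adj? G)
  open ZykovUniqueness t (adj? G) (symm G) (irrefl G)

  private
    q : ℕ
    q = suc t

  -- `U` followed by the labelling of `R` lists every vertex once, which makes `h` a bijection;
  -- adjacency is compared on the side of the model graph and carried over by the inverse.
  Joined-IsTurán⇒≅ : ∀ U R → allFin n ↭ U ++ R → Joined U R → IsTurán R → G ≅ extremalGraph t (length U) (length R)
  Joined-IsTurán⇒≅ U R p (U! , U-R) (f , f↭ , f-turán) =
    mk↔ₛ′ h⁻¹ h (λ y → h-injective (h-h⁻¹ (h y))) h-h⁻¹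
    , λ x y → mk⇔
        (λ a → proj₁ (h-adj (h⁻¹ x) (h⁻¹ y)) (subst₂ (Adj G) (sym (h-h⁻¹ x)) (sym (h-h⁻¹ y)) a))
        (λ a → subst₂ (Adj G) (h-h⁻¹ x) (h-h⁻¹ y) (proj₂ (h-adj (h⁻¹ x) (h⁻¹ y)) a))
    where
    k = length U
    N = length R

    place : Fin k ⊎ Fin N → Fin n
    place = [ lookup U , f ∘ toℕ ]′

    h : Fin (k + N) → Fin n
    h = place ∘ splitAt k

    h↭ : tabulate h ↭ allFin n
    h↭ = ↭-trans (↭-reflexive (≡.trans (tabulate-+ k h) (cong₂ _++_
        (≡.trans (tabulate-cong λ i → cong place (Fin.splitAt-↑ˡ k i N)) (tabulate-lookup U))
        (≡.trans (tabulate-cong λ j → cong place (Fin.splitAt-↑ʳ k N j)) (tabulate-toℕ N f)))))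
      (↭-trans (↭.++⁺ˡ U f↭) (↭-sym p))

    h-injective : ∀ {a b} → h a ≡ h b → a ≡ b
    h-injective = Unique-tabulate⇒injective h (Unique-resp-↭ (↭-sym h↭) (Unique.allFin⁺ n))

    h-surjective : ∀ x → ∃ λ a → x ≡ h a
    h-surjective x = ∈-tabulate⁻ (↭.∈-resp-↭ (↭-sym h↭) (∈-allFin x))

    h⁻¹ : Fin n → Fin (k + N)
    h⁻¹ x = proj₁ (h-surjective x)

    h-h⁻¹ : ∀ x → h (h⁻¹ x) ≡ x
    h-h⁻¹ x = sym (proj₂ (h-surjective x))

    f∈R : ∀ (j : Fin N) → f (toℕ j) ∈ R
    f∈R j = ↭.∈-resp-↭ f↭ (∈-applyUpTo⁺ f (Fin.toℕ<n j))

    U-f : ∀ i j → Adj G (lookup U i) (f (toℕ j))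
    U-f i j = All.lookup (All.lookup U-R (∈-lookup i)) (f∈R j)

    place-adj : ∀ u v → (Adj G (place u) (place v) → JoinAdj (K k) (turán q N) u v) ×
                        (JoinAdj (K k) (turán q N) u v → Adj G (place u) (place v))
    place-adj (inj₁ i) (inj₁ j) = (λ a i≡j → irrefl G (cong (lookup U) i≡j) a) , Clique-lookup G U!
    place-adj (inj₁ i) (inj₂ j) = (λ _ → tt) , λ _ → U-f i j
    place-adj (inj₂ i) (inj₁ j) = (λ _ → tt) , λ _ → symm G (U-f j i)
    place-adj (inj₂ i) (inj₂ j) = f-turán (Fin.toℕ<n i) (Fin.toℕ<n j)

    h-adj : ∀ a b → (Adj G (h a) (h b) → Adj (extremalGraph t k N) a b) ×
                    (Adj (extremalGraph t k N) a b → Adj G (h a) (h b))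
    h-adj a b = place-adj (splitAt k a) (splitAt k b)

-- Deleting k vertices loses only O(n ^ t) cliques of order 1 + t, which makes T(n) and T(n - k)
-- comparable up to errors.
z-+≤ : ∀ t N k {n} → N + k ≤ n → z t (N + k) (suc t) ≤ z t N (suc t) + k * n ^ t
z-+≤ t N k {n} N+k≤n = begin
  z t (N + k) q               ≡⟨ cong (T.cl q) (applyUpTo-+ id N k) ⟩
  T.cl q (upTo N ++ S)        ≡⟨ T.cl-↭ (_∘ sym) q (↭.++-comm (upTo N) S) ⟩
  T.cl q (S ++ upTo N)        ≤⟨ T.cl-++≤ t S (upTo N) (≤-trans (≤-reflexive S++upTo) N+k≤n) ⟩
  length S * n ^ t + z t N q  ≡⟨ cong (λ m → m * n ^ t + z t N q) (length-applyUpTo (N +_) k) ⟩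
  k * n ^ t + z t N q         ≡⟨ +-comm (k * n ^ t) _ ⟩
  z t N q + k * n ^ t         ∎
  where
  open ≤-Reasoning
  q = suc t
  module T = Cliques (turánAdj? t)
  S = applyUpTo (N +_) k
  S++upTo : length (S ++ upTo N) ≡ N + k
  S++upTo = ≡.trans (length-++ S) (≡.trans (cong₂ _+_ (length-applyUpTo (N +_) k) (length-upTo N)) (+-comm k N))

-- Comparison with the extremal graph for large n

module _ (t k′ n : ℕ) (k≤n : suc k′ ≤ n) (q≤N : suc t ≤ n ∸ suc k′)
         (large : (error (2 + t) (suc k′) + suc k′ * suc k′) * n ^ t < z t n (suc t)) where

  private
    q r k N Z : ℕ
    q = suc t
    r = suc q
    k = suc k′
    N = n ∸ k
    Z = z t n q

    H : Graph (k + N)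
    H = extremalGraph t k N

    -- The spare `Z` on the right beats all errors. The summand k * k in `large` arises from
    -- replacing `Z` by `z t N q` in k places, at a cost of k * n ^ t each.
    J+few : k * Z + error r k * n ^ t < J k r (z t N) + Z
    J+few = begin-strict
      k * Z + error r k * n ^ t
        ≤⟨ +-monoˡ-≤ _ (*-monoʳ-≤ k Z≤) ⟩
      k * (z t N q + k * n ^ t) + error r k * n ^ t
        ≡⟨ solve 4 (λ K Y P E → K :* (Y :+ K :* P) :+ E :* P := K :* Y :+ (E :+ K :* K) :* P)
             refl k (z t N q) (n ^ t) (error r k) ⟩
      k * z t N q + (error r k + k * k) * n ^ t
        <⟨ +-mono-≤-< (k*f≤J k q (z t N)) large ⟩
      J k r (z t N) + Z ∎
      where
      open ≤-Reasoning
      open +-*-Solver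
      n≡N+k : n ≡ N + k
      n≡N+k = sym (m∸n+n≡m k≤n)
      Z≤ : Z ≤ z t N q + k * n ^ t
      Z≤ = subst (λ m → z t m q ≤ z t N q + k * n ^ t) (sym n≡N+k) (z-+≤ t N k (≤-reflexive (sym n≡N+k)))

  module _ (G : Graph n) where

    open Cliques (adj? G)
    open Joins (adj? G)
    open Packings t (adj? G) (symm G)
    open Zykov t (adj? G) (symm G)
    open ZykovUniqueness t (adj? G) (symm G) (irrefl G)

    free⇒#K≤ : G IsFreeOf ((k + 1) · K r) → #K r G ≤ J k r (z t N) × (#K r G ≡ J k r (z t N) → G ≅ H)
    free⇒#K≤ free with apex-or-few n k (allFin n) (≤-reflexive (length-tabulate id))
                         (free ∘ subst (λ m → (m · K r) ⊑ G) (+-comm 1 k) ∘ Packing⇒⊑ G t (suc k))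
    -- The bound is strict here, so the equality case concerns graphs with k apices only.
    ... | inj₂ few = <⇒≤ #K<J , λ eq → contradiction eq (<⇒≢ #K<J)
      where
      #K<J : #K r G < J k r (z t N)
      #K<J = subst (_< J k r (z t N)) (sym (#K≡cl G r)) (+-cancelʳ-< Z _ _ (≤-<-trans few J+few))
    ... | inj₁ (U , R , p , ∣U∣≡k , R-free) =
      ≤-trans (≤-reflexive #K≡) (≤-trans ≤₁ ≤₂) , unique
      where
      n≡ : n ≡ k + length R
      n≡ = ≡.trans (sym (length-tabulate id)) (≡.trans (↭.↭-length p)
             (≡.trans (length-++ U) (cong (_+ length R) ∣U∣≡k)))
      ∣R∣≡N : length R ≡ N
      ∣R∣≡N = sym (≡.trans (cong (_∸ k) n≡) (m+n∸m≡n k (length R)))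
      #K≡ : #K r G ≡ cl r (U ++ R)
      #K≡ = ≡.trans (#K≡cl G r) (cl-↭ (symm G) r p)
      cl≤z : ∀ i → cl i R ≤ z t N i
      cl≤z i = ≤-trans (zykov {R} R-free i) (≤-reflexive (cong (λ m → z t m i) ∣R∣≡N))
      ≤₁ : cl r (U ++ R) ≤ J k r (λ i → cl i R)
      ≤₁ = ≤-trans (cl-++≤J r U R) (≤-reflexive (cong (λ m → J m r (λ i → cl i R)) ∣U∣≡k))
      ≤₂ : J k r (λ i → cl i R) ≤ J k r (z t N)
      ≤₂ = J-mono-≤ k r cl≤z
      unique : #K r G ≡ J k r (z t N) → G ≅ H
      unique eq = subst₂ (λ k N → G ≅ extremalGraph t k N) ∣U∣≡k ∣R∣≡N
        (Joined-IsTurán⇒≅ t G U R p (cl-≡J⇒Joined (λ {i} → symm G {i}) (irrefl G) t U R pos ext joined-eq) R-turán)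
        where
        eq₁ : cl r (U ++ R) ≡ J k r (z t N)
        eq₁ = ≡.trans (sym #K≡) eq
        q≤R : q ≤ length R
        q≤R = ≤-trans q≤N (≤-reflexive (sym ∣R∣≡N))
        -- At order r both counts vanish, so the structure of `R` is read off at order q = r - 1,
        -- whose coefficient is k.
        cl-q : cl q R ≡ z t (length R) q
        cl-q = ≡.trans (J-suc-≡⇒≡ k′ q cl≤z (≤-antisym ≤₂ (≤-trans (≤-reflexive (sym eq₁)) ≤₁)))
                       (cong (λ m → z t m q) (sym ∣R∣≡N))
        joined-eq : cl r (U ++ R) ≡ J (length U) r (λ i → cl i R)
        joined-eq = ≡.trans (≤-antisym ≤₁ (≤-trans ≤₂ (≤-reflexive (sym eq₁))))
                            (cong (λ m → J m r (λ i → cl i R)) (sym ∣U∣≡k))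
        -- Any vertex will do; it only fills the labelling beyond its length.
        default : Fin n
        default = fromℕ< (≤-trans (s≤s z≤n) k≤n)
        R-turán : IsTurán R
        R-turán = zykov-unique default R-free
          (subst (λ i → cl i R ≡ z t (length R) i) (sym (m≥n⇒m⊓n≡n q≤R)) cl-q)
        pos = proj₁ (IsTurán⇒extends q≤R R-turán)
        ext = proj₂ (IsTurán⇒extends q≤R R-turán)

  IsEx-extremalGraph : IsEx n r ((k + 1) · K r) (#K r H)
  IsEx-extremalGraph = maximum⇒IsEx (m+[n∸m]≡n k≤n) H (extremalGraph-free t k N (m<m+n k z<s))
    λ G free → ≤-trans (proj₁ (free⇒#K≤ G free)) (≤-reflexive (sym (#K-extremalGraph t k N r)))

  IsExtremal⇔≅ : (G : Graph n) → IsExtremal r ((k + 1) · K r) G ⇔ (G ≅ H)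
  IsExtremal⇔≅ G = mk⇔
    (λ (free , ex) → proj₂ (free⇒#K≤ G free)
      (≡.trans (IsEx-unique ex IsEx-extremalGraph) (#K-extremalGraph t k N r)))
    (λ G≅H → extremalGraph-free t k N (m<m+n k z<s) ∘ ⊑-resp-≅ {G = G} {H = H} G≅H {F = (k + 1) · K r}
      , subst (IsEx n r ((k + 1) · K r)) (sym (#K-resp-≅ {G = G} {H = H} G≅H r)) IsEx-extremalGraph)

theorem6 : (k r : ℕ) → 1 ≤ k → (2≤r : 2 ≤ r) →
    ∃ λ (n₀ : ℕ) → (n : ℕ) → n₀ ≤ n →
      let F = (k + 1) · K r
          H = K k +ᴳ turán (r ∸ 1) {{>-nonZero (m<n⇒0<n∸m 2≤r)}} (n ∸ k)
      in IsEx n r F (#K r H) ×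
         ((G : Graph n) → IsExtremal r F G ⇔ (G ≅ H))
theorem6 (suc k′) (suc (suc t)) (s≤s _) (s≤s (s≤s _))
  with n₁ , growth ← z-growth t (error (2 + t) (suc k′) + suc k′ * suc k′)
  -- The part `suc k′ + suc t` leaves at least q vertices outside the apices, so no Turán class is
  -- empty; `n₁` makes the main term exceed the errors.
  = suc k′ + suc t + n₁ , λ n n₀≤n →
      let k+q≤n = ≤-trans (m≤m+n (suc k′ + suc t) n₁) n₀≤n
          k≤n   = ≤-trans (m≤m+n (suc k′) (suc t)) k+q≤n
          q≤N   = ≤-trans (≤-reflexive (sym (m+n∸m≡n (suc k′) (suc t)))) (∸-monoˡ-≤ (suc k′) k+q≤n)
          large = growth n (≤-trans (m≤n+m n₁ (suc k′ + suc t)) n₀≤n)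
      in IsEx-extremalGraph t k′ n k≤n q≤N large , IsExtremal⇔≅ t k′ n k≤n q≤N large
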